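{- Let $F$ be a finite forest without isolated vertices. Then the following are equivalent: (a) every connected component of $F$ is either a star or $2$-internally extendable; (b) every $2$-matching of $F$ extends to a perfect internal matching of $F$; (c) $F$ is strongly equistarable; (d) $F$ is equistarable; (e) $F$ is $P_5$-constrained.
   Context: A star is a graph isomorphic to $K_{1,n}$ for some $n\ge 1$. A matching is a set of pairwise disjoint edges; a $k$-matching is a matching with exactly $k$ edges. A matching $M$ extends to $M'$ if $M\subseteq M'$. A matching $M$ is a perfect internal matching if every vertex not covered by $M$ is a leaf (degree $1$ vertex). For $k\ge1$, a connected graph is $k$-internally extendable if it contains a $k$-matching and every $k$-matching extends to a perfect internal matching. For a vertex $v$, $E(v)$ denotes the set of edges incident with $v$ (the star rooted at $v$); a star $E(v)$ is maximal if it is not properly contained in another star $E(u)$. A graph $G=(V,E)$ without isolated vertices is equistarable if there is $\varphi:E\to\mathbb{R}_+$ such that for all $F\subseteq E$, $F$ is a maximal star iff $\sum_{e\in F}\varphi(e)=1$. With $\mathcal{S}^*(G)$ the set of maximal stars and $\mathcal{T}^*(G)$ the set of other nonempty edge subsets, $G$ (without isolated vertices) is strongly equistarable if for every $T\in\mathcal{T}^*(G)$ and every $\gamma\le1$ there is $\varphi:E\to\mathbb{R}_+$ with $\varphi(S)=1$ for all $S\in\mathcal{S}^*(G)$ and $\varphi(T)\ne\gamma$. A graph is $P_5$-constrained if the middle vertex of every (not necessarily induced) path on $5$ vertices in the graph has degree at least $3$.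
   Formalization: In the definitions of equistarable and strongly equistarable, the edge weights φ and the number γ ≤ 1 are taken rational instead of real. -}

module Defs where

open import Data.Nat using (ℕ; zero; suc; _<_; _≤_; _<ᵇ_)
import Data.Nat as N
open import Data.Fin using (Fin; toℕ; inject₁; fromℕ) renaming (zero to fzero; suc to fsuc)
import Data.Fin as F
open import Data.Bool using (Bool; true; false; _∧_; _∨_; if_then_else_)
open import Data.Product using (Σ; ∃; _×_; _,_)
open import Data.Sum using (_⊎_)
open import Relation.Nullary using (¬_; ⌊_⌋)
open import Relation.Binary.PropositionalEquality using (_≡_; _≢_)
open import Data.Rational using (ℚ; 0ℚ; 1ℚ) renaming (_+_ to _+ℚ_; _≤_ to _≤ℚ_)
open import Function.Bundles using (_⇔_)

record Graph : Set where
  field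
    n      : ℕ
    adj    : Fin n → Fin n → Bool
    sym    : ∀ i j → adj i j ≡ adj j i
    irrefl : ∀ i → adj i i ≡ false
open Graph public

ΣFinℕ : (n : ℕ) → (Fin n → ℕ) → ℕ
ΣFinℕ zero    f = 0
ΣFinℕ (suc n) f = f fzero N.+ ΣFinℕ n (λ i → f (fsuc i))

ΣFinℚ : (n : ℕ) → (Fin n → ℚ) → ℚ
ΣFinℚ zero    f = 0ℚ
ΣFinℚ (suc n) f = f fzero +ℚ ΣFinℚ n (λ i → f (fsuc i))

module _ (G : Graph) where
  private
    V = Fin (n G)
    A = adj G

  Adj : V → V → Set
  Adj u v = A u v ≡ true

  deg : V → ℕ
  deg v = ΣFinℕ (n G) (λ u → if A v u then 1 else 0)

  NoIsolated : Set
  NoIsolated = ∀ v → ∃ λ u → Adj v u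

  Reachable : V → V → Set
  Reachable u v = Σ ℕ λ k → Σ (Fin (suc k) → V) λ f →
    (f fzero ≡ u) × (f (fromℕ k) ≡ v) × (∀ (i : Fin k) → Adj (f (inject₁ i)) (f (fsuc i)))

  Connected : Set
  Connected = (1 ≤ n G) × (∀ u v → Reachable u v)

  Injective : ∀ {m} → (Fin m → V) → Set
  Injective f = ∀ i j → f i ≡ f j → i ≡ j

  Cycle : Set
  Cycle = Σ ℕ λ k → (2 ≤ k) × Σ (Fin (suc k) → V) λ f → Injective f ×
    (∀ (i : Fin k) → Adj (f (inject₁ i)) (f (fsuc i))) × Adj (f (fromℕ k)) (f fzero)

  Forest : Set
  Forest = ¬ Cycle

  P5Constrained : Set
  P5Constrained = ∀ (f : Fin 5 → V) → Injective f →
    (∀ (i : Fin 4) → Adj (f (inject₁ i)) (f (fsuc i))) → 3 ≤ deg (f (F.suc (F.suc fzero)))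

  -- Edge sets. An edge {i,j} is encoded by the ordered pair (i,j) with
  -- toℕ i < toℕ j. A set of edges is a Boolean function on pairs that is
  -- true only on such encoded edges.

  EdgeSet : Set
  EdgeSet = V → V → Bool

  SubE : EdgeSet → Set
  SubE S = ∀ i j → S i j ≡ true → (toℕ i < toℕ j) × Adj i j

  isEdge : V → V → Bool
  isEdge i j = (toℕ i <ᵇ toℕ j) ∧ A i j

  NonEmptyE : EdgeSet → Set
  NonEmptyE S = ∃ λ i → ∃ λ j → S i j ≡ true

  _⊆E_ : EdgeSet → EdgeSet → Set
  S ⊆E T = ∀ i j → S i j ≡ true → T i j ≡ true

  SameE : EdgeSet → EdgeSet → Set
  SameE S T = ∀ i j → S i j ≡ T i j

  sizeE : EdgeSet → ℕ
  sizeE S = ΣFinℕ (n G) (λ i → ΣFinℕ (n G) (λ j → if S i j then 1 else 0))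

  weight : (V → V → ℚ) → EdgeSet → ℚ
  weight φ S = ΣFinℚ (n G) (λ i → ΣFinℚ (n G) (λ j → if S i j then φ i j else 0ℚ))

  starE : V → EdgeSet
  starE v i j = isEdge i j ∧ (⌊ i F.≟ v ⌋ ∨ ⌊ j F.≟ v ⌋)

  ProperSub : EdgeSet → EdgeSet → Set
  ProperSub S T = (S ⊆E T) × (∃ λ i → ∃ λ j → (T i j ≡ true) × (S i j ≡ false))

  MaximalStarAt : V → Set
  MaximalStarAt v = NonEmptyE (starE v) × ¬ (∃ λ u → ProperSub (starE v) (starE u))

  IsMaximalStar : EdgeSet → Set
  IsMaximalStar S = ∃ λ v → MaximalStarAt v × SameE S (starE v)

  NonNeg : (V → V → ℚ) → Set
  NonNeg φ = ∀ i j → Adj i j → 0ℚ ≤ℚ φ i j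

  Equistarable : Set
  Equistarable = NoIsolated × (Σ (V → V → ℚ) λ φ → NonNeg φ ×
    (∀ S → SubE S → (IsMaximalStar S ⇔ (weight φ S ≡ 1ℚ))))

  StronglyEquistarable : Set
  StronglyEquistarable = NoIsolated × (∀ T → SubE T → NonEmptyE T → ¬ IsMaximalStar T →
    ∀ (γ : ℚ) → γ ≤ℚ 1ℚ → Σ (V → V → ℚ) λ φ → NonNeg φ ×
      (∀ S → SubE S → IsMaximalStar S → weight φ S ≡ 1ℚ) × (weight φ T ≢ γ))

  IsMatching : EdgeSet → Set
  IsMatching M = SubE M × (∀ a b c d → M a b ≡ true → M c d ≡ true →
    (a ≡ c ⊎ a ≡ d ⊎ b ≡ c ⊎ b ≡ d) → (a ≡ c) × (b ≡ d))

  IsKMatching : ℕ → EdgeSet → Set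
  IsKMatching k M = IsMatching M × (sizeE M ≡ k)

  Covered : EdgeSet → V → Set
  Covered M v = ∃ λ u → (M v u ≡ true) ⊎ (M u v ≡ true)

  PerfectInternal : EdgeSet → Set
  PerfectInternal M = IsMatching M × (∀ v → ¬ Covered M v → deg v ≡ 1)

  ExtendsToPIM : EdgeSet → Set
  ExtendsToPIM M = Σ EdgeSet λ M' → (M ⊆E M') × PerfectInternal M'

  InternallyExtendable : ℕ → Set
  InternallyExtendable k = Connected × (∃ λ M → IsKMatching k M) ×
    (∀ M → IsKMatching k M → ExtendsToPIM M)

K1 : (m : ℕ) → Graph
K1 m = record { n = suc m ; adj = a ; sym = s ; irrefl = ir }
  where
    a : Fin (suc m) → Fin (suc m) → Bool
    a fzero    fzero    = false
    a fzero    (fsuc _) = true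
    a (fsuc _) fzero    = true
    a (fsuc _) (fsuc _) = false
    s : ∀ i j → a i j ≡ a j i
    s fzero    fzero    = _≡_.refl
    s fzero    (fsuc _) = _≡_.refl
    s (fsuc _) fzero    = _≡_.refl
    s (fsuc _) (fsuc _) = _≡_.refl
    ir : ∀ i → a i i ≡ false
    ir fzero    = _≡_.refl
    ir (fsuc _) = _≡_.refl

Isomorphic : Graph → Graph → Set
Isomorphic G H = Σ (Fin (n G) → Fin (n H)) λ f → Σ (Fin (n H) → Fin (n G)) λ g →
  (∀ x → g (f x) ≡ x) × (∀ y → f (g y) ≡ y) × (∀ x y → adj H (f x) (f y) ≡ adj G x y)

IsStar : Graph → Set
IsStar G = Σ ℕ λ m → (1 ≤ m) × Isomorphic G (K1 m)

IsComponent : (H G : Graph) → (Fin (n H) → Fin (n G)) → Set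
IsComponent H G e = Injective G e × (∀ x y → adj G (e x) (e y) ≡ adj H x y) ×
  Connected H × (∀ x v → Adj G (e x) v → ∃ λ y → e y ≡ v)

CondA : Graph → Set
CondA G = ∀ (H : Graph) (e : Fin (n H) → Fin (n G)) → IsComponent H G e →
  IsStar H ⊎ InternallyExtendable H 2

CondB : Graph → Set
CondB G = ∀ M → IsKMatching G 2 M → ExtendsToPIM G M

{-# OPTIONS --safe #-}
-- Everything is compared with the P₅ condition. In a forest a vertex c of degree 2 in the middle of a
-- path a–b–c–d–e is left uncovered by every matching containing ab and de, and makes
-- (E(b) ∪ E(d)) ∖ E(c) weigh 1 + 1 − 1 under every weighting of value 1 on the maximal stars.
-- Conversely, under the P₅ condition any at most two disjoint edges extend greedily to a matching that
-- covers all internal vertices and is maximal. Such a matching meets every maximal star exactly once,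
-- so its indicator is an admissible weighting. A nonempty edge set T that is not a maximal star either
-- contains two disjoint edges, and then some such matching meets T twice, or is a proper part of a
-- maximal star, and then one such matching meets T once and another avoids it. Hence indicators give
-- strong equistarability, and one generic combination of them gives equistarability.
module Submission where

open import Defs
open import Data.Bool using (Bool; true; false; _∧_; _∨_; not; if_then_else_)
open import Data.Bool.Properties using (T-≡) renaming (_≟_ to _≟ᵇ_)
open import Data.Empty using (⊥; ⊥-elim)
open import Data.Fin using (Fin; toℕ; inject₁; fromℕ; fromℕ<; _≟_) renaming (zero to fzero; suc to fsuc)
open import Data.Fin.Permutation using (Permutation; transpose; _⟨$⟩ʳ_; _⟨$⟩ˡ_; inverseˡ; inverseʳ)
open import Data.Fin.Properties using (any?; toℕ-injective)
open import Data.List using (List; []; _∷_; length; lookup; map; cartesianProduct; allFin; filter)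
open import Data.List.Membership.Propositional using (_∈_)
open import Data.List.Membership.Propositional.Properties using (∈-lookup; ∈-allFin; ∈-filter⁺; ∈-filter⁻; ∈-map⁺; ∈-cartesianProduct⁺)
open import Data.List.Relation.Unary.All using (All; []; _∷_; universal) renaming (map to All-map; lookup to All-lookup)
open import Data.List.Relation.Unary.All.Properties using (¬Any⇒All¬) renaming (map⁺ to All-map⁺)
open import Data.List.Relation.Unary.AllPairs using ([]; _∷_)
open import Data.List.Relation.Unary.Any using (here; there; index)
open import Data.List.Relation.Unary.Any.Properties using (lookup-index)
open import Data.List.Relation.Unary.Unique.Propositional using (Unique)
open import Data.Nat using (ℕ; zero; suc; _+_; _*_; _≤_; _<_; z≤n; s≤s; s≤s⁻¹; _≤?_)
open import Data.Nat.DivMod using (_%_; m<n⇒m%n≡m; [m+kn]%n≡m%n)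
open import Data.Nat.Properties hiding (_≟_)
open import Data.Product using (Σ; ∃; _×_; _,_; proj₁; proj₂)
open import Data.Sum using (_⊎_; inj₁; inj₂; [_,_]; swap)
open import Function using (_∘_)
open import Function.Bundles using (_⇔_; mk⇔; Equivalence)
open import Relation.Binary.Construct.Closure.ReflexiveTransitive using (Star; ε; _◅_; _◅◅_; reverse) renaming (map to Star-map)
open import Relation.Binary.PropositionalEquality using (_≡_; _≢_; refl; cong; cong₂; trans; subst; module ≡-Reasoning) renaming (sym to ≡-sym)
open import Relation.Nullary using (¬_; Dec; yes; no; ⌊_⌋)
open import Data.List.Relation.Unary.Unique.Propositional.Properties using (map⁺; allFin⁺; filter⁺)
open import Relation.Binary.Definitions using (tri<; tri≈; tri>)
open import Algebra.Bundles using (CommutativeMonoid)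
import Data.Rational as ℚ
import Data.Rational.Properties as ℚ
open import Data.Rational using (ℚ; 0ℚ; 1ℚ)
open import Relation.Nullary.Decidable using (map′; dec-true; _×-dec_; _⊎-dec_; ¬?; decidable-stable; ¬¬-excluded-middle)

-- Greedy extension can fail by using up the last free neighbour of an internal vertex that is still
-- uncovered. The invariant `Extendable` guards against this: vertices in such danger lie in
-- different components of the uncovered subgraph, so the one next to the growing matching can be
-- served before it is stranded. The P₅ condition only establishes the invariant for a start with at
-- most two edges; after that acyclicity alone preserves it. Two is the limit: in the spider with
-- three legs of length 2, the three outer edges leave the centre without a free neighbour. Two
-- prescribed edges are also all that the detection of an edge set asks for. A finite family of
-- matchings, indexed by quadruples of vertices, therefore serves every edge set at once.
-- Equistarability needs a single weighting, so the numbers of hits with the whole family are packed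
-- as digits into one number, which is then scaled to make the value of a maximal star 1.

bit : Bool → ℕ
bit b = if b then 1 else 0

bit≤1 : ∀ b → bit b ≤ 1
bit≤1 true  = ≤-refl
bit≤1 false = z≤n

∧-true : ∀ {x y} → x ∧ y ≡ true → x ≡ true × y ≡ true
∧-true {true} {true} _ = refl , refl

∧-intro : ∀ {x y} → x ≡ true → y ≡ true → x ∧ y ≡ true
∧-intro refl refl = refl

∨-true : ∀ {x y} → x ∨ y ≡ true → x ≡ true ⊎ y ≡ true
∨-true {true}  _ = inj₁ refl
∨-true {false} e = inj₂ e

∨-introˡ : ∀ {x y} → x ≡ true → x ∨ y ≡ true
∨-introˡ refl = refl

∨-introʳ : ∀ {x y} → y ≡ true → x ∨ y ≡ true
∨-introʳ {true}  _ = refl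
∨-introʳ {false} e = e

true≢false : ∀ {b} → b ≡ true → b ≡ false → ⊥
true≢false refl ()

≢true⇒false : ∀ {b} → b ≢ true → b ≡ false
≢true⇒false {true}  h = ⊥-elim (h refl)
≢true⇒false {false} _ = refl

⌊⌋-true : ∀ {P : Set} (d : Dec P) → P → ⌊ d ⌋ ≡ true
⌊⌋-true (yes _) _ = refl
⌊⌋-true (no ¬p) p = ⊥-elim (¬p p)

⌊⌋-holds : ∀ {P : Set} (d : Dec P) → ⌊ d ⌋ ≡ true → P
⌊⌋-holds (yes p) _ = p

⌊⌋-false : ∀ {P : Set} (d : Dec P) → ¬ P → ⌊ d ⌋ ≡ false
⌊⌋-false (yes p) ¬p = ⊥-elim (¬p p)
⌊⌋-false (no _)  _  = refl

bool-ext : ∀ {x y} → (x ≡ true → y ≡ true) → (y ≡ true → x ≡ true) → x ≡ y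
bool-ext {true}  f g = ≡-sym (f refl)
bool-ext {false} {true}  f g = g refl
bool-ext {false} {false} f g = refl

-- Finite sums and counting

Σ-cong : ∀ m {f g : Fin m → ℕ} → (∀ i → f i ≡ g i) → ΣFinℕ m f ≡ ΣFinℕ m g
Σ-cong zero    e = refl
Σ-cong (suc m) e = cong₂ _+_ (e fzero) (Σ-cong m (e ∘ fsuc))

Σ-mono : ∀ m {f g : Fin m → ℕ} → (∀ i → f i ≤ g i) → ΣFinℕ m f ≤ ΣFinℕ m g
Σ-mono zero    e = z≤n
Σ-mono (suc m) e = +-mono-≤ (e fzero) (Σ-mono m (e ∘ fsuc))

Σ-suc : ∀ m {f g : Fin m → ℕ} a → (∀ i → i ≢ a → f i ≡ g i) → f a ≡ suc (g a) →
        ΣFinℕ m f ≡ suc (ΣFinℕ m g)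
Σ-suc (suc m) fzero    e s = cong₂ _+_ s (Σ-cong m (λ i → e (fsuc i) (λ ())))
Σ-suc (suc m) {f} {g} (fsuc a) e s = begin
  f fzero + ΣFinℕ m (f ∘ fsuc)
    ≡⟨ cong₂ _+_ (e fzero (λ ())) (Σ-suc m a (λ i i≢a → e (fsuc i) (λ { refl → i≢a refl })) s) ⟩
  g fzero + suc (ΣFinℕ m (g ∘ fsuc))
    ≡⟨ +-suc (g fzero) _ ⟩
  suc (g fzero + ΣFinℕ m (g ∘ fsuc)) ∎
  where open ≡-Reasoning

Σ-zero : ∀ m {f : Fin m → ℕ} → (∀ i → f i ≡ 0) → ΣFinℕ m f ≡ 0
Σ-zero zero    e = refl
Σ-zero (suc m) e = cong₂ _+_ (e fzero) (Σ-zero m (e ∘ fsuc))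

Σ-positive : ∀ m {f : Fin m → ℕ} → 1 ≤ ΣFinℕ m f → ∃ λ i → 1 ≤ f i
Σ-positive (suc m) {f} h with f fzero in eq
... | suc k = fzero , subst (1 ≤_) (≡-sym eq) (s≤s z≤n)
... | zero with Σ-positive m h
...   | i , p = fsuc i , p

bit-positive : ∀ {b} → 1 ≤ bit b → b ≡ true
bit-positive {true} _ = refl

count : ∀ {m} → (Fin m → Bool) → ℕ
count {m} p = ΣFinℕ m (λ i → bit (p i))

_∖_ : ∀ {m} → (Fin m → Bool) → Fin m → Fin m → Bool
(p ∖ a) i = p i ∧ not ⌊ i ≟ a ⌋

module _ {m} (p : Fin m → Bool) where

  ∖-≢ : ∀ {a i} → i ≢ a → (p ∖ a) i ≡ p i
  ∖-≢ {a} {i} i≢a rewrite ⌊⌋-false (i ≟ a) i≢a with p i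
  ... | true  = refl
  ... | false = refl

  ∖-≡ : ∀ a → (p ∖ a) a ≡ false
  ∖-≡ a rewrite ⌊⌋-true (a ≟ a) refl with p a
  ... | true  = refl
  ... | false = refl

  ∖-true : ∀ {a i} → (p ∖ a) i ≡ true → p i ≡ true × i ≢ a
  ∖-true e = proj₁ (∧-true e) , λ { refl → true≢false e (∖-≡ _) }

  count-∖ : ∀ a → p a ≡ true → count p ≡ suc (count (p ∖ a))
  count-∖ a pa = Σ-suc m a (λ i i≢a → cong bit (≡-sym (∖-≢ i≢a)))
    (trans (cong bit pa) (cong (suc ∘ bit) (≡-sym (∖-≡ a))))

  -- Deleting a point costs at most one, whether or not it was counted, so `another-nbr` and
  -- `third-nbr` can avoid arbitrary vertices.
  count-∖-≤ : ∀ {k} a → suc k ≤ count p → k ≤ count (p ∖ a)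
  count-∖-≤ {k} a h with p a in eq
  ... | true  = s≤s⁻¹ (subst (suc k ≤_) (count-∖ a eq) h)
  ... | false = subst (k ≤_) (Σ-cong m same) (≤-trans (n≤1+n k) h)
    where
    same : ∀ i → bit (p i) ≡ bit ((p ∖ a) i)
    same i with i ≟ a
    ... | yes refl = cong bit (trans eq (≡-sym (cong (_∧ false) eq)))
    ... | no _ with p i
    ...   | true  = refl
    ...   | false = refl

  count-positive : 1 ≤ count p → ∃ λ i → p i ≡ true
  count-positive h with Σ-positive m h
  ... | i , q = i , bit-positive q

count-mono : ∀ {m} {p q : Fin m → Bool} → (∀ i → p i ≡ true → q i ≡ true) → count p ≤ count q
count-mono {m} {p} {q} h = Σ-mono m λ i → lemma i (p i) refl
  where
  lemma : ∀ i b → p i ≡ b → bit b ≤ bit (q i)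
  lemma i true  e = ≤-reflexive (≡-sym (cong bit (h i e)))
  lemma i false e = z≤n

Σℚ-cong : ∀ m {f g : Fin m → ℚ} → (∀ i → f i ≡ g i) → ΣFinℚ m f ≡ ΣFinℚ m g
Σℚ-cong zero    e = refl
Σℚ-cong (suc m) e = cong₂ ℚ._+_ (e fzero) (Σℚ-cong m (e ∘ fsuc))

Σℚ-+ : ∀ m (f g : Fin m → ℚ) → ΣFinℚ m (λ i → f i ℚ.+ g i) ≡ ΣFinℚ m f ℚ.+ ΣFinℚ m g
Σℚ-+ zero    f g = refl
Σℚ-+ (suc m) f g = trans (cong ((f fzero ℚ.+ g fzero) ℚ.+_) (Σℚ-+ m (f ∘ fsuc) (g ∘ fsuc)))
  (interchange (f fzero) (g fzero) _ _)
  where open import Algebra.Properties.CommutativeSemigroup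
               (CommutativeMonoid.commutativeSemigroup ℚ.+-0-commutativeMonoid) using (interchange)

-- Lets a sum of numerals be taken digit by digit: `natWeight-value` applies it with `f` the lowest
-- digit and `g` the remaining numeral.
Σ-affine : ∀ m b (f g : Fin m → ℕ) → ΣFinℕ m (λ i → f i + g i * b) ≡ ΣFinℕ m f + ΣFinℕ m g * b
Σ-affine zero    b f g = refl
Σ-affine (suc m) b f g = begin
  (f fzero + g fzero * b) + ΣFinℕ m (λ i → f (fsuc i) + g (fsuc i) * b)
    ≡⟨ cong (f fzero + g fzero * b +_) (Σ-affine m b (f ∘ fsuc) (g ∘ fsuc)) ⟩
  (f fzero + g fzero * b) + (F + H * b)
    ≡⟨ interchange (f fzero) (g fzero * b) F (H * b) ⟩
  (f fzero + F) + (g fzero * b + H * b)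
    ≡⟨ cong (f fzero + F +_) (*-distribʳ-+ b (g fzero) H) ⟨
  (f fzero + F) + (g fzero + H) * b ∎
  where
  open ≡-Reasoning
  open import Algebra.Properties.CommutativeSemigroup +-commutativeSemigroup using (interchange)
  F = ΣFinℕ m (f ∘ fsuc)
  H = ΣFinℕ m (g ∘ fsuc)

-- Positional numerals, least significant digit first

numeral : {A : Set} → ℕ → (A → ℕ) → List A → ℕ
numeral b digit []       = 0
numeral b digit (x ∷ xs) = digit x + numeral b digit xs * b

numeral-cong : ∀ {A : Set} b {f g : A → ℕ} {xs} → All (λ x → f x ≡ g x) xs → numeral b f xs ≡ numeral b g xs
numeral-cong b []       = refl
numeral-cong b (e ∷ es) = cong₂ (λ x y → x + y * b) e (numeral-cong b es)

-- With digits below the base, the lowest one is the remainder modulo the base; cancelling it and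
-- one factor of the base leaves the shorter numerals.
numeral-injective : ∀ {A : Set} b {f g : A → ℕ} xs → (∀ x → f x < suc b) → (∀ x → g x < suc b) →
                    numeral (suc b) f xs ≡ numeral (suc b) g xs → All (λ x → f x ≡ g x) xs
numeral-injective b [] hf hg e = []
numeral-injective b {f} {g} (x ∷ xs) hf hg e = digit ∷
  numeral-injective b xs hf hg (*-cancelʳ-≡ F H (suc b) (+-cancelˡ-≡ (f x) _ _
    (trans e (cong (_+ H * suc b) (≡-sym digit)))))
  where
  open ≡-Reasoning
  F = numeral (suc b) f xs
  H = numeral (suc b) g xs
  digit : f x ≡ g x
  digit = begin
    f x                          ≡⟨ m<n⇒m%n≡m (hf x) ⟨
    f x % suc b                  ≡⟨ [m+kn]%n≡m%n (f x) F (suc b) ⟨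
    (f x + F * suc b) % suc b    ≡⟨ cong (_% suc b) e ⟩
    (g x + H * suc b) % suc b    ≡⟨ [m+kn]%n≡m%n (g x) H (suc b) ⟩
    g x % suc b                  ≡⟨ m<n⇒m%n≡m (hg x) ⟩
    g x ∎

-- Natural numbers inside the rationals

ι : ℕ → ℚ
ι zero    = 0ℚ
ι (suc k) = 1ℚ ℚ.+ ι k

ι-+ : ∀ a b → ι (a + b) ≡ ι a ℚ.+ ι b
ι-+ zero    b = ≡-sym (ℚ.+-identityˡ (ι b))
ι-+ (suc a) b = trans (cong (1ℚ ℚ.+_) (ι-+ a b)) (≡-sym (ℚ.+-assoc 1ℚ (ι a) (ι b)))

0<1 : 0ℚ ℚ.< 1ℚ
0<1 = ℚ.positive⁻¹ 1ℚ

ι-suc-< : ∀ k → ι k ℚ.< ι (suc k)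
ι-suc-< k = subst (ℚ._< ι (suc k)) (ℚ.+-identityˡ (ι k)) (ℚ.+-monoˡ-< (ι k) 0<1)

ι-mono-< : ∀ {a b} → a < b → ι a ℚ.< ι b
ι-mono-< {a} {suc b} (s≤s a≤b) with m≤n⇒m<n∨m≡n a≤b
... | inj₁ a<b  = ℚ.<-trans (ι-mono-< a<b) (ι-suc-< b)
... | inj₂ refl = ι-suc-< a

ι≥0 : ∀ k → 0ℚ ℚ.≤ ι k
ι≥0 zero    = ℚ.≤-refl
ι≥0 (suc k) = ℚ.<⇒≤ (ι-mono-< {0} {suc k} (s≤s z≤n))

ι-injective : ∀ {a b} → ι a ≡ ι b → a ≡ b
ι-injective {a} {b} e with <-cmp a b
... | tri< a<b _ _ = ⊥-elim (ℚ.<⇒≢ (ι-mono-< a<b) e)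
... | tri≈ _ a≡b _ = a≡b
... | tri> _ _ b<a = ⊥-elim (ℚ.<⇒≢ (ι-mono-< b<a) (≡-sym e))

Σ-ι : ∀ m q (f : Fin m → ℕ) → ΣFinℚ m (λ i → q ℚ.* ι (f i)) ≡ q ℚ.* ι (ΣFinℕ m f)
Σ-ι zero    q f = ≡-sym (ℚ.*-zeroʳ q)
Σ-ι (suc m) q f = trans (cong (q ℚ.* ι (f fzero) ℚ.+_) (Σ-ι m q (f ∘ fsuc)))
  (trans (≡-sym (ℚ.*-distribˡ-+ q (ι (f fzero)) (ι (ΣFinℕ m (f ∘ fsuc)))))
    (cong (q ℚ.*_) (≡-sym (ι-+ (f fzero) _))))

inverse : ∀ q → 0ℚ ℚ.< q → ∃ λ r → 0ℚ ℚ.≤ r × r ℚ.* q ≡ 1ℚ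
inverse q 0<q = ℚ.1/ q , ℚ.<⇒≤ (ℚ.positive⁻¹ (ℚ.1/ q)) , ℚ.*-inverseˡ q
  where instance
    q-positive = ℚ.positive 0<q
    q-nonzero  = ℚ.pos⇒nonZero q
    r-positive = ℚ.1/pos⇒pos q

*-nonneg : ∀ {p q} → 0ℚ ℚ.≤ p → 0ℚ ℚ.≤ q → 0ℚ ℚ.≤ p ℚ.* q
*-nonneg {p} {q} p≥0 q≥0 = ℚ.nonNegative⁻¹ (p ℚ.* q)
  where instance
    p-nonneg = ℚ.nonNegative p≥0
    q-nonneg = ℚ.nonNegative q≥0
    pq-nonneg = ℚ.nonNeg*nonNeg⇒nonNeg p q

-- Walks, paths and cycles

module _ (G : Graph) where
  private
    V = Fin (n G)
    _~_ = Adj G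

  ~-sym : ∀ {u v} → u ~ v → v ~ u
  ~-sym {u} {v} e = trans (sym G v u) e

  ~⇒≢ : ∀ {u v} → u ~ v → u ≢ v
  ~⇒≢ {u} e refl = true≢false e (irrefl G u)

  _~?_ : ∀ u v → Dec (u ~ v)
  u ~? v = adj G u v ≟ᵇ true

  2≤deg : ∀ {v a b} → v ~ a → v ~ b → a ≢ b → 2 ≤ deg G v
  2≤deg {v} {a} {b} va vb a≢b
    rewrite count-∖ (adj G v) a va
          | count-∖ (adj G v ∖ a) b (trans (∖-≢ (adj G v) (a≢b ∘ ≡-sym)) vb) = s≤s (s≤s z≤n)

  3≤deg : ∀ {v a b c} → v ~ a → v ~ b → v ~ c → a ≢ b → a ≢ c → b ≢ c → 3 ≤ deg G v
  3≤deg {v} {a} {b} {c} va vb vc a≢b a≢c b≢c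
    rewrite count-∖ (adj G v) a va
          | count-∖ (adj G v ∖ a) b (trans (∖-≢ (adj G v) (a≢b ∘ ≡-sym)) vb)
          | count-∖ ((adj G v ∖ a) ∖ b) c (trans (∖-≢ (adj G v ∖ a) (b≢c ∘ ≡-sym))
              (trans (∖-≢ (adj G v) (a≢c ∘ ≡-sym)) vc)) = s≤s (s≤s (s≤s z≤n))

  another-nbr : ∀ {v} → 2 ≤ deg G v → ∀ a → ∃ λ b → v ~ b × b ≢ a
  another-nbr {v} h a with count-positive _ (count-∖-≤ (adj G v) a h)
  ... | b , e = b , ∖-true (adj G v) e

  third-nbr : ∀ {v} → 3 ≤ deg G v → ∀ a b → ∃ λ c → v ~ c × c ≢ a × c ≢ b
  third-nbr {v} h a b with count-positive _ (count-∖-≤ _ b (count-∖-≤ (adj G v) a h))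
  ... | c , e with ∖-true (adj G v ∖ a) e
  ...   | e′ , c≢b with ∖-true (adj G v) e′
  ...     | vc , c≢a = c , vc , c≢a , c≢b

  two-nbrs : ∀ {v} → 2 ≤ deg G v → ∃ λ a → ∃ λ b → v ~ a × v ~ b × a ≢ b
  two-nbrs {v} h with count-positive (adj G v) (≤-trans (n≤1+n 1) h)
  ... | a , va with another-nbr h a
  ...   | b , vb , b≢a = a , b , va , vb , b≢a ∘ ≡-sym

  deg<2⇒unique-nbr : ∀ {v a b} → deg G v < 2 → v ~ a → v ~ b → a ≡ b
  deg<2⇒unique-nbr {v} {a} {b} h va vb with a ≟ b
  ... | yes e = e
  ... | no  a≢b = ⊥-elim (<⇒≱ h (2≤deg va vb a≢b))

  deg<2⇒deg≡1 : ∀ {v} → NoIsolated G → deg G v < 2 → deg G v ≡ 1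
  deg<2⇒deg≡1 {v} ni h with ni v
  ... | a , va = ≤-antisym (s≤s⁻¹ h) (subst (1 ≤_) (≡-sym (count-∖ (adj G v) a va)) (s≤s z≤n))

  -- Both ends are required to lie in `U`, so that walks can be reversed. The empty walk says
  -- nothing about its vertex, hence the separate `U y` in `loop-erase`.
  Step : (V → Set) → V → V → Set
  Step U x y = U x × U y × x ~ y

  Walk : (V → Set) → V → V → Set
  Walk U = Star (Step U)

  Walk-sym : ∀ {U x y} → Walk U x y → Walk U y x
  Walk-sym = reverse λ { (ux , uy , e) → uy , ux , ~-sym e }

  Walk-mono : ∀ {U W : V → Set} {x y} → (∀ {z} → U z → W z) → Walk U x y → Walk W x y
  Walk-mono h = Star-map λ { (ux , uy , e) → h ux , h uy , e }

  data Path : V → V → List V → Set where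
    stop : ∀ {x} → Path x x (x ∷ [])
    step : ∀ {x z y vs} → x ~ z → Path z y vs → All (x ≢_) vs → Path x y (x ∷ vs)

  Path-unique : ∀ {x y vs} → Path x y vs → Unique vs
  Path-unique stop         = [] ∷ []
  Path-unique (step _ p h) = h ∷ Path-unique p

  suffix : ∀ {U : V → Set} {x z y vs} → x ∈ vs → Path z y vs → All U vs →
           ∃ λ ws → Path x y ws × All U ws
  suffix (here refl) stop             us       = _ , stop , us
  suffix (here refl) p@(step _ _ _)   us       = _ , p , us
  suffix (there i)   (step _ p _)     (_ ∷ us) = suffix i p us

  open import Data.List.Membership.DecPropositional (_≟_ {n G}) using (_∈?_)

  -- If the first vertex recurs on the erased remainder, the suffix from that occurrence is already
  -- the wanted path.
  loop-erase : ∀ {U : V → Set} {x y} → U y → Walk U x y → ∃ λ vs → Path x y vs × All U vs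
  loop-erase uy ε = _ , stop , uy ∷ []
  loop-erase {x = x} uy ((ux , uz , e) ◅ w) with loop-erase uy w
  ... | vs , p , us with x ∈? vs
  ...   | yes i = suffix i p us
  ...   | no  i = x ∷ vs , step e p (¬Any⇒All¬ _ i) , ux ∷ us

  lookup-injective : ∀ {vs : List V} → Unique vs → ∀ i j → lookup vs i ≡ lookup vs j → i ≡ j
  lookup-injective (h ∷ u) fzero    fzero    e = refl
  lookup-injective (h ∷ u) fzero    (fsuc j) e = ⊥-elim (All-lookup h (∈-lookup j) e)
  lookup-injective (h ∷ u) (fsuc i) fzero    e = ⊥-elim (All-lookup h (∈-lookup i) (≡-sym e))
  lookup-injective (h ∷ u) (fsuc i) (fsuc j) e = cong fsuc (lookup-injective u i j e)

  -- Prepending `r` produces the sequence that `Cycle` expects, whose closing edge leads from the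
  -- last vertex of the path back to `r`.
  Path-steps : ∀ {r x y vs} → Path x y vs → r ~ x → ∀ (i : Fin (length vs)) →
               lookup (r ∷ vs) (inject₁ i) ~ lookup (r ∷ vs) (fsuc i)
  Path-steps stop         rx fzero    = rx
  Path-steps (step _ _ _) rx fzero    = rx
  Path-steps (step e p _) rx (fsuc i) = Path-steps p e i

  Path-last : ∀ {r x y vs} → Path x y vs → lookup (r ∷ vs) (fromℕ (length vs)) ≡ y
  Path-last stop         = refl
  Path-last (step _ p _) = Path-last p

  -- A `Cycle` has at least three vertices; with `r` in front, the path has to contribute two.
  Path-length : ∀ {x y vs} → Path x y vs → x ≢ y → 2 ≤ length vs
  Path-length stop                    x≢y = ⊥-elim (x≢y refl)
  Path-length (step _ stop _)         _   = s≤s (s≤s z≤n)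
  Path-length (step _ (step _ _ _) _) _   = s≤s (s≤s z≤n)

  module _ (forest : Forest G) where

    -- The basic use of acyclicity: erased to a path that avoids `r`, the walk closes to a cycle
    -- through `r`.
    no-bypass : ∀ {r x y} → r ~ x → r ~ y → x ≢ y → ¬ Walk (r ≢_) x y
    no-bypass {r} rx ry x≢y w with loop-erase (~⇒≢ ry) w
    ... | vs , p , r∉vs = forest
      ( length vs , Path-length p x≢y , lookup (r ∷ vs)
      , lookup-injective (r∉vs ∷ Path-unique p) , Path-steps p rx
      , subst (_~ r) (≡-sym (Path-last p)) (~-sym ry))

    no-triangle : ∀ {a b c} → a ~ b → b ~ c → ¬ a ~ c
    no-triangle ab bc ac = no-bypass ab ac (~⇒≢ bc) ((~⇒≢ ab , ~⇒≢ ac , bc) ◅ ε)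

    -- Contracting the edge r–w would turn the walk into a cycle.
    no-bypass-edge : ∀ {U : V → Set} {r w x y} → r ~ w → x ≢ y → x ~ r ⊎ x ~ w → y ~ r ⊎ y ~ w →
                     U x → U y → (∀ {z} → U z → z ≢ r × z ≢ w) → ¬ Walk U x y
    no-bypass-edge {U} {r} {w} {x} {y} rw x≢y hx hy ux uy avoid k = go hx hy k
      where
      avoid-r : ∀ {z} → U z → r ≢ z
      avoid-r uz e = proj₁ (avoid uz) (≡-sym e)
      avoid-w : ∀ {z} → U z → w ≢ z
      avoid-w uz e = proj₂ (avoid uz) (≡-sym e)
      go : x ~ r ⊎ x ~ w → y ~ r ⊎ y ~ w → Walk U x y → ⊥
      go (inj₁ xr) (inj₁ yr) k = no-bypass (~-sym xr) (~-sym yr) x≢y (Walk-mono avoid-r k)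
      go (inj₂ xw) (inj₂ yw) k = no-bypass (~-sym xw) (~-sym yw) x≢y (Walk-mono avoid-w k)
      -- When the ends are attached to different ends of the edge, the walk is prolonged to `w` and
      -- so joins two neighbours of `r`.
      go (inj₁ xr) (inj₂ yw) k = no-bypass (~-sym xr) rw (proj₂ (avoid ux))
        (Walk-mono avoid-r k ◅◅ (avoid-r uy , ~⇒≢ rw , yw) ◅ ε)
      go (inj₂ xw) (inj₁ yr) k = no-bypass (~-sym yr) rw (proj₂ (avoid uy))
        (Walk-mono avoid-r (Walk-sym k) ◅◅ (avoid-r ux , ~⇒≢ rw , xw) ◅ ε)

  P5-middle : P5Constrained G → ∀ {a b c d e} → a ~ b → b ~ c → c ~ d → d ~ e →
              Unique (a ∷ b ∷ c ∷ d ∷ e ∷ []) → 3 ≤ deg G c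
  P5-middle p5 {a} {b} {c} {d} {e} ab bc cd de u =
    p5 (lookup (a ∷ b ∷ c ∷ d ∷ e ∷ [])) (lookup-injective u) steps
    where
    steps : ∀ (i : Fin 4) → lookup (a ∷ b ∷ c ∷ d ∷ e ∷ []) (inject₁ i) ~ lookup (b ∷ c ∷ d ∷ e ∷ []) i
    steps fzero                         = ab
    steps (fsuc fzero)                  = bc
    steps (fsuc (fsuc fzero))           = cd
    steps (fsuc (fsuc (fsuc fzero)))    = de

  -- Matchings as involutions: the fixed points are the uncovered vertices.

  record Matching : Set where
    field
      partner : V → V
      invol   : ∀ v → partner (partner v) ≡ v
      joined  : ∀ {v} → partner v ≢ v → v ~ partner v

    Uncovered : V → Set
    Uncovered v = partner v ≡ v

    Uncovered? : ∀ v → Dec (Uncovered v)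
    Uncovered? v = partner v ≟ v

    partner-injective : ∀ {u v} → partner u ≡ partner v → u ≡ v
    partner-injective {u} {v} e = trans (≡-sym (invol u)) (trans (cong partner e) (invol v))

    joined⇒covered : ∀ {u v} → partner u ≡ v → u ~ v → ¬ Uncovered u
    joined⇒covered pu uv unc = ~⇒≢ uv (trans (≡-sym unc) pu)

    -- The second clause matters for components with a single edge, both of whose ends are leaves:
    -- it forces that edge into the matching, because its star is maximal.
    Saturating : Set
    Saturating = ∀ v → Uncovered v → deg G v < 2 × (∀ u → v ~ u → ¬ Uncovered u)

    TwoFree : V → Set
    TwoFree v = ∃ λ a → ∃ λ b → (v ~ a × Uncovered a) × (v ~ b × Uncovered b) × a ≢ b

    TwoFree? : ∀ v → Dec (TwoFree v)
    TwoFree? v = any? λ a → any? λ b →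
      ((v ~? a) ×-dec Uncovered? a) ×-dec ((v ~? b) ×-dec Uncovered? b) ×-dec ¬? (a ≟ b)

    -- Together with `free-nbr` this means exactly one free neighbour, so an edge that takes this
    -- neighbour for another vertex would strand `v`.
    Deficient : V → Set
    Deficient v = Uncovered v × 2 ≤ deg G v × ¬ TwoFree v

    Deficient? : ∀ v → Dec (Deficient v)
    Deficient? v = Uncovered? v ×-dec (2 ≤? deg G v) ×-dec ¬? (TwoFree? v)

    -- The invariant of the greedy extension. Adding an edge may take the last free neighbour only from
    -- a deficient vertex next to it, and separation leaves no deficient vertex there but the one matched.
    record Extendable : Set where
      field
        free-nbr  : ∀ v → Uncovered v → 2 ≤ deg G v → ∃ λ u → v ~ u × Uncovered u
        separated : ∀ {x y} → Deficient x → Deficient y → x ≢ y → ¬ Walk Uncovered x y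

  open Matching

  _⊑_ : Matching → Matching → Set
  M ⊑ M′ = ∀ v → ¬ Uncovered M v → partner M′ v ≡ partner M v

  emptyMatching : Matching
  emptyMatching = record { partner = λ v → v ; invol = λ _ → refl ; joined = λ h → ⊥-elim (h refl) }

  module AddEdge (M : Matching) {r w : V} (ur : Uncovered M r) (uw : Uncovered M w) (rw : r ~ w) where

    partner′ : V → V
    partner′ v = if ⌊ v ≟ r ⌋ then w else if ⌊ v ≟ w ⌋ then r else partner M v

    at-r : partner′ r ≡ w
    at-r rewrite ⌊⌋-true (r ≟ r) refl = refl

    at-w : partner′ w ≡ r
    at-w rewrite ⌊⌋-false (w ≟ r) (~⇒≢ rw ∘ ≡-sym) | ⌊⌋-true (w ≟ w) refl = refl

    elsewhere : ∀ {v} → v ≢ r → v ≢ w → partner′ v ≡ partner M v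
    elsewhere {v} v≢r v≢w rewrite ⌊⌋-false (v ≟ r) v≢r | ⌊⌋-false (v ≟ w) v≢w = refl

    location : ∀ v → v ≡ r ⊎ v ≡ w ⊎ (v ≢ r × v ≢ w)
    location v with v ≟ r | v ≟ w
    ... | yes e | _     = inj₁ e
    ... | no  _ | yes e = inj₂ (inj₁ e)
    ... | no  a | no b  = inj₂ (inj₂ (a , b))

    partner-≢-uncovered : ∀ {v x} → Uncovered M x → v ≢ x → partner M v ≢ x
    partner-≢-uncovered {v} ux v≢x e = v≢x (partner-injective M (trans e (≡-sym ux)))

    invol′ : ∀ v → partner′ (partner′ v) ≡ v
    invol′ v with location v
    ... | inj₁ refl        = trans (cong partner′ at-r) at-w
    ... | inj₂ (inj₁ refl) = trans (cong partner′ at-w) at-r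
    ... | inj₂ (inj₂ (v≢r , v≢w)) = trans (cong partner′ (elsewhere v≢r v≢w))
      (trans (elsewhere (partner-≢-uncovered ur v≢r) (partner-≢-uncovered uw v≢w)) (invol M v))

    joined′ : ∀ {v} → partner′ v ≢ v → v ~ partner′ v
    joined′ {v} h with location v
    ... | inj₁ refl        = subst (r ~_) (≡-sym at-r) rw
    ... | inj₂ (inj₁ refl) = subst (w ~_) (≡-sym at-w) (~-sym rw)
    ... | inj₂ (inj₂ (v≢r , v≢w)) = subst (v ~_) (≡-sym (elsewhere v≢r v≢w))
      (joined M (h ∘ trans (elsewhere v≢r v≢w)))

    M⁺ : Matching
    M⁺ = record { partner = partner′ ; invol = invol′ ; joined = joined′ }

    uncovered⁻ : ∀ {v} → Uncovered M⁺ v → Uncovered M v × v ≢ r × v ≢ w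
    uncovered⁻ {v} u with location v
    ... | inj₁ refl        = ⊥-elim (~⇒≢ rw (≡-sym (trans (≡-sym at-r) u)))
    ... | inj₂ (inj₁ refl) = ⊥-elim (~⇒≢ rw (trans (≡-sym at-w) u))
    ... | inj₂ (inj₂ (v≢r , v≢w)) = trans (≡-sym (elsewhere v≢r v≢w)) u , v≢r , v≢w

    uncovered⁺ : ∀ {v} → Uncovered M v → v ≢ r → v ≢ w → Uncovered M⁺ v
    uncovered⁺ u v≢r v≢w = trans (elsewhere v≢r v≢w) u

    extends : M ⊑ M⁺
    extends v c = elsewhere (λ { refl → c ur }) (λ { refl → c uw })

  ⊑-trans : ∀ {M N O} → M ⊑ N → N ⊑ O → M ⊑ O
  ⊑-trans h k v c = trans (k v λ u → c (trans (≡-sym (h v c)) u)) (h v c)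

  uncovered-count : Matching → ℕ
  uncovered-count M = count (λ v → ⌊ Uncovered? M v ⌋)

  Disjoint : V → V → V → V → Set
  Disjoint a b c d = (a ≢ c × a ≢ d) × (b ≢ c × b ≢ d)

  Disjoint? : ∀ a b c d → Dec (Disjoint a b c d)
  Disjoint? a b c d = (¬? (a ≟ c) ×-dec ¬? (a ≟ d)) ×-dec (¬? (b ≟ c) ×-dec ¬? (b ≟ d))

  -- Greedy extension of a matching

  module _ (forest : Forest G) where

    module _ (M : Matching) (X : Extendable M) where
      open Extendable X

      module _ {r w} (ur : Uncovered M r) (uw : Uncovered M w) (rw : r ~ w)
               (alone : ∀ {x} → Deficient M x → x ≢ r → ¬ Walk (Uncovered M) x r) where
        open AddEdge M ur uw rw

        near : V → Set
        near v = v ~ r ⊎ v ~ w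

        not-both : ∀ {v a b} → v ~ a → v ~ b → a ≢ b → (a ≡ r ⊎ a ≡ w) → (b ≡ r ⊎ b ≡ w) → ⊥
        not-both va vb a≢b (inj₁ refl) (inj₁ refl) = a≢b refl
        not-both va vb a≢b (inj₁ refl) (inj₂ refl) = no-triangle forest va rw vb
        not-both va vb a≢b (inj₂ refl) (inj₁ refl) = no-triangle forest vb rw va
        not-both va vb a≢b (inj₂ refl) (inj₂ refl) = a≢b refl

        still-free : ∀ {u} → Uncovered M u → (u ≡ r ⊎ u ≡ w) ⊎ Uncovered M⁺ u
        still-free {u} uu with location u
        ... | inj₁ e               = inj₁ (inj₁ e)
        ... | inj₂ (inj₁ e)        = inj₁ (inj₂ e)
        ... | inj₂ (inj₂ (a , b))  = inj₂ (uncovered⁺ uu a b)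

        to-r : ∀ {v u} → Uncovered M v → v ~ u → u ≡ r ⊎ u ≡ w → Walk (Uncovered M) v r
        to-r uv vu (inj₁ refl) = (uv , ur , vu) ◅ ε
        to-r uv vu (inj₂ refl) = (uv , uw , vu) ◅ (uw , ur , ~-sym rw) ◅ ε

        -- A vertex with two free neighbours keeps one of them: `r` and `w` are adjacent and cannot
        -- both be its neighbours without a triangle. A vertex with a single one is deficient, and
        -- losing it would give a walk to `r`, against `alone`.
        free-nbr⁺ : ∀ v → Uncovered M⁺ v → 2 ≤ deg G v → ∃ λ u → v ~ u × Uncovered M⁺ u
        free-nbr⁺ v uv⁺ iv with uncovered⁻ uv⁺
        ... | uv , v≢r , v≢w with TwoFree? M v
        ...   | yes (a , b , (va , ua) , (vb , ub) , a≢b) with still-free ua | still-free ub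
        ...     | inj₂ ua⁺ | _        = a , va , ua⁺
        ...     | inj₁ _   | inj₂ ub⁺ = b , vb , ub⁺
        ...     | inj₁ ea  | inj₁ eb  = ⊥-elim (not-both va vb a≢b ea eb)
        free-nbr⁺ v uv⁺ iv | uv , v≢r , v≢w | no ¬two with free-nbr v uv iv
        ... | u , vu , uu with still-free uu
        ...   | inj₂ uu⁺ = u , vu , uu⁺
        ...   | inj₁ e   = ⊥-elim (alone (uv , iv , ¬two) v≢r (to-r uv vu e))

        -- A vertex that had two free neighbours and now is deficient has lost one of them to the
        -- new edge.
        deficient⁻ : ∀ {v} → Deficient M⁺ v → Deficient M v ⊎ (∃ λ u → v ~ u × (u ≡ r ⊎ u ≡ w))
        deficient⁻ {v} (uv⁺ , iv , ¬two⁺) with uncovered⁻ uv⁺ | TwoFree? M v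
        ... | uv , _ | no ¬two = inj₁ (uv , iv , ¬two)
        ... | uv , _ | yes (a , b , (va , ua) , (vb , ub) , a≢b) with still-free ua | still-free ub
        ...   | inj₁ e   | _        = inj₂ (a , va , e)
        ...   | inj₂ _   | inj₁ e   = inj₂ (b , vb , e)
        ...   | inj₂ ua⁺ | inj₂ ub⁺ = ⊥-elim (¬two⁺ (a , b , (va , ua⁺) , (vb , ub⁺) , a≢b))

        to-near : ∀ {v} → (∃ λ u → v ~ u × (u ≡ r ⊎ u ≡ w)) → near v
        to-near (u , vu , inj₁ refl) = inj₁ vu
        to-near (u , vu , inj₂ refl) = inj₂ vu

        -- Two old deficient vertices are separated already. An old one connected to a new one is
        -- connected through it to `r`, against `alone`. Two new ones both touch the edge from `r`
        -- to `w`, and a walk that misses this edge would create a cycle.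
        separated⁺ : ∀ {x y} → Deficient M⁺ x → Deficient M⁺ y → x ≢ y → ¬ Walk (Uncovered M⁺) x y
        separated⁺ {x} {y} dx⁺ dy⁺ x≢y k⁺ = go (deficient⁻ dx⁺) (deficient⁻ dy⁺)
          where
          k : Walk (Uncovered M) x y
          k = Walk-mono (proj₁ ∘ uncovered⁻) k⁺
          x≢r : x ≢ r
          x≢r = proj₁ (proj₂ (uncovered⁻ (proj₁ dx⁺)))
          y≢r : y ≢ r
          y≢r = proj₁ (proj₂ (uncovered⁻ (proj₁ dy⁺)))
          go : _ → _ → ⊥
          go (inj₁ dx) (inj₁ dy) = separated dx dy x≢y k
          go (inj₁ dx) (inj₂ (u , yu , e)) = alone dx x≢r (k ◅◅ to-r (proj₁ (uncovered⁻ (proj₁ dy⁺))) yu e)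
          go (inj₂ (u , xu , e)) (inj₁ dy) =
            alone dy y≢r (Walk-sym k ◅◅ to-r (proj₁ (uncovered⁻ (proj₁ dx⁺))) xu e)
          go (inj₂ nx) (inj₂ ny) = no-bypass-edge forest rw x≢y (to-near nx) (to-near ny)
            (proj₁ dx⁺) (proj₁ dy⁺) (proj₂ ∘ uncovered⁻) k⁺

        extendable⁺ : Extendable M⁺
        extendable⁺ = record { free-nbr = free-nbr⁺ ; separated = separated⁺ }

        count⁺ : uncovered-count M⁺ < uncovered-count M
        count⁺ = subst (suc (uncovered-count M⁺) ≤_)
          (≡-sym (count-∖ (λ v → ⌊ Uncovered? M v ⌋) r (⌊⌋-true (Uncovered? M r) ur)))
          (s≤s (count-mono λ v e → shrink (uncovered⁻ (⌊⌋-holds (Uncovered? M⁺ v) e))))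
          where
          shrink : ∀ {v} → Uncovered M v × v ≢ r × v ≢ w → ((λ v → ⌊ Uncovered? M v ⌋) ∖ r) v ≡ true
          shrink {v} (u , v≢r , _) = trans (∖-≢ (λ v → ⌊ Uncovered? M v ⌋) v≢r) (⌊⌋-true (Uncovered? M v) u)

      -- A deficient vertex, if there is one, is matched first: its free neighbour could get lost.
      seed : (∃ λ r → ∃ λ w → Uncovered M r × Uncovered M w × r ~ w ×
               (∀ {x} → Deficient M x → x ≢ r → ¬ Walk (Uncovered M) x r))
             ⊎ (∀ v u → Uncovered M v → v ~ u → ¬ Uncovered M u)
      seed with any? (Deficient? M)
      ... | yes (r , dr@(ur , ir , _)) with free-nbr r ur ir
      ...   | w , rw , uw = inj₁ (r , w , ur , uw , rw , λ dx x≢r → separated dx dr x≢r)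
      seed | no ¬d with any? (λ r → any? λ w → Uncovered? M r ×-dec Uncovered? M w ×-dec (r ~? w))
      ... | yes (r , w , ur , uw , rw) = inj₁ (r , w , ur , uw , rw , λ dx → ⊥-elim (¬d (_ , dx)))
      ... | no ¬e = inj₂ λ v u uv vu uu → ¬e (v , u , uv , uu , vu)

    -- Every new edge lowers the number of uncovered vertices, which `k` bounds. Once no edge
    -- between uncovered vertices is left, the invariant itself shows that no internal vertex is
    -- uncovered, since it would still have a free neighbour.
    extend : ∀ k M → uncovered-count M ≤ k → Extendable M → Σ Matching λ M′ → M ⊑ M′ × Saturating M′
    extend k M h X with seed M X
    ... | inj₂ none = M , (λ _ _ → refl) , λ v uv → ≰⇒> (internal-covered v uv) , λ u vu → none v u uv vu
      where
      internal-covered : ∀ v → Uncovered M v → ¬ 2 ≤ deg G v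
      internal-covered v uv iv with Extendable.free-nbr X v uv iv
      ... | u , vu , uu = none v u uv vu uu
    extend zero M h X | inj₁ (r , w , ur , uw , rw , alone) =
      ⊥-elim (n≮0 (<-≤-trans (count⁺ M X ur uw rw alone) h))
    extend (suc k) M h X | inj₁ (r , w , ur , uw , rw , alone)
      with extend k (AddEdge.M⁺ M ur uw rw) (s≤s⁻¹ (<-≤-trans (count⁺ M X ur uw rw alone) h))
             (extendable⁺ M X ur uw rw alone)
    ... | M′ , ext , sat = M′ , ⊑-trans {M} {AddEdge.M⁺ M ur uw rw} {M′} (AddEdge.extends M ur uw rw) ext , sat

    -- Matchings with at most two edges under the P₅ condition

    module _ (p5 : P5Constrained G) where

      -- A pigeonhole form, in which two of any three covered vertices share an edge. It names no
      -- edges, so that starts with none, one or two of them are handled alike.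
      AtMostTwoEdges : Matching → Set
      AtMostTwoEdges M = ∀ {s t u} → ¬ Uncovered M s → ¬ Uncovered M t → ¬ Uncovered M u →
        (s ≡ t ⊎ s ≡ partner M t) ⊎ (s ≡ u ⊎ s ≡ partner M u) ⊎ (t ≡ u ⊎ t ≡ partner M u)

      module _ (M : Matching) (few : AtMostTwoEdges M) where

        ≢-covered : ∀ {x y} → Uncovered M x → ¬ Uncovered M y → x ≢ y
        ≢-covered ux cy refl = cy ux

        ≢-partner : ∀ {x y} → Uncovered M x → ¬ Uncovered M y → x ≢ partner M y
        ≢-partner {x} {y} ux cy e =
          cy (trans (≡-sym e) (trans (≡-sym ux) (trans (cong (partner M) e) (invol M y))))

        nbr-≢-partner : ∀ {v s t} → v ~ s → v ~ t → ¬ Uncovered M t → s ≢ partner M t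
        nbr-≢-partner vs vt ct refl = no-triangle forest vt (joined M ct) vs

        -- Two covered neighbours put v in the middle of a P5, which forces a third neighbour;
        -- that one cannot lie on the at most two edges of M as well.
        initial-free-nbr : ∀ v → Uncovered M v → 2 ≤ deg G v → ∃ λ u → v ~ u × Uncovered M u
        initial-free-nbr v uv iv with two-nbrs iv
        ... | s , t , vs , vt , s≢t with Uncovered? M s | Uncovered? M t
        ...   | yes us | _      = s , vs , us
        ...   | no _   | yes ut = t , vt , ut
        ...   | no cs  | no ct with third-nbr (P5-middle p5 (~-sym (joined M cs)) (~-sym vs) vt (joined M ct) distinct) s t
          where
          distinct : Unique (partner M s ∷ s ∷ v ∷ t ∷ partner M t ∷ [])
          distinct = (cs ∷ (≢-partner uv cs ∘ ≡-sym) ∷ (nbr-≢-partner vt vs cs ∘ ≡-sym)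
                       ∷ (s≢t ∘ partner-injective M) ∷ [])
            ∷ ((≢-covered uv cs ∘ ≡-sym) ∷ s≢t ∷ nbr-≢-partner vs vt ct ∷ [])
            ∷ (≢-covered uv ct ∷ ≢-partner uv ct ∷ [])
            ∷ ((ct ∘ ≡-sym) ∷ []) ∷ [] ∷ []
        ...     | u , vu , u≢s , u≢t with Uncovered? M u
        ...       | yes uu = u , vu , uu
        ...       | no cu with few cs ct cu
        ...         | inj₁ (inj₁ e) = ⊥-elim (s≢t e)
        ...         | inj₁ (inj₂ e) = ⊥-elim (nbr-≢-partner vs vt ct e)
        ...         | inj₂ (inj₁ (inj₁ e)) = ⊥-elim (u≢s (≡-sym e))
        ...         | inj₂ (inj₁ (inj₂ e)) = ⊥-elim (nbr-≢-partner vs vu cu e)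
        ...         | inj₂ (inj₂ (inj₁ e)) = ⊥-elim (u≢t (≡-sym e))
        ...         | inj₂ (inj₂ (inj₂ e)) = ⊥-elim (nbr-≢-partner vt vu cu e)

        one-free-nbr : ∀ {x y z} → Deficient M x → x ~ y → Uncovered M y → x ~ z → Uncovered M z → y ≡ z
        one-free-nbr {y = y} {z} (_ , _ , ¬two) xy uy xz uz with y ≟ z
        ... | yes e  = e
        ... | no y≢z = ⊥-elim (¬two (y , z , (xy , uy) , (xz , uz) , y≢z))

        covered-nbr : ∀ {x} → Deficient M x → ∃ λ a → x ~ a × ¬ Uncovered M a
        covered-nbr dx@(_ , ix , ¬two) with two-nbrs ix
        ... | s , t , xs , xt , s≢t with Uncovered? M s | Uncovered? M t
        ...   | no cs  | _      = s , xs , cs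
        ...   | yes _  | no ct  = t , xt , ct
        ...   | yes us | yes ut = ⊥-elim (¬two (s , t , (xs , us) , (xt , ut) , s≢t))

        -- A walk between deficient vertices links two distinct edges of M; the P5 from the
        -- first of them through x then gives x a third neighbour on one of the two edges.
        initial-separated : ∀ {x y} → Deficient M x → Deficient M y → x ≢ y → ¬ Walk (Uncovered M) x y
        initial-separated {x} {y} dx@(ux , ix , ¬twox) dy@(uy , iy , _) x≢y k
          with covered-nbr dx | covered-nbr dy | initial-free-nbr x ux ix
        ... | a , xa , ca | c , yc , cc | f , xf , uf = go (any? λ z → (f ~? z) ×-dec ¬? (z ≟ x))
          where
          no-bypass-M : ∀ {b x y} → ¬ Uncovered M b → Uncovered M x → Uncovered M y → x ≢ y →
                        x ~ b ⊎ x ~ partner M b → y ~ b ⊎ y ~ partner M b → ¬ Walk (Uncovered M) x y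
          no-bypass-M cb ux uy x≢y hx hy = no-bypass-edge forest (joined M cb) x≢y hx hy ux uy
            λ uz → ≢-covered uz cb , ≢-partner uz cb
          go : Dec (∃ λ z → f ~ z × z ≢ x) → ⊥
          go (yes (z , fz , z≢x)) = third (third-nbr (P5-middle p5 (~-sym (joined M ca)) (~-sym xa) xf fz distinct) a f)
            where
            z≢a : z ≢ a
            z≢a refl = no-triangle forest xf fz xa
            z≢pa : z ≢ partner M a
            z≢pa refl = no-bypass-M ca ux uf (~⇒≢ xf) (inj₁ xa) (inj₂ fz) ((ux , uf , xf) ◅ ε)
            distinct : Unique (partner M a ∷ a ∷ x ∷ f ∷ z ∷ [])
            distinct = (ca ∷ (≢-partner ux ca ∘ ≡-sym) ∷ (≢-partner uf ca ∘ ≡-sym) ∷ (z≢pa ∘ ≡-sym) ∷ [])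
              ∷ ((≢-covered ux ca ∘ ≡-sym) ∷ (≢-covered uf ca ∘ ≡-sym) ∷ (z≢a ∘ ≡-sym) ∷ [])
              ∷ (~⇒≢ xf ∷ (z≢x ∘ ≡-sym) ∷ [])
              ∷ (~⇒≢ fz ∷ []) ∷ [] ∷ []
            third : (∃ λ u → x ~ u × u ≢ a × u ≢ f) → ⊥
            third (u , xu , u≢a , u≢f) with Uncovered? M u
            ... | yes uu = u≢f (≡-sym (one-free-nbr dx xf uf xu uu))
            -- If `a` and `u` share an edge of `M`, there is a triangle with `x`. If one of them
            -- shares the edge of `c`, both `x` and `y` touch that edge and the walk between them
            -- closes a cycle.
            ... | no cu with few ca cu cc
            ...   | inj₁ (inj₁ e)    = u≢a (≡-sym e)
            ...   | inj₁ (inj₂ e)    = nbr-≢-partner xa xu cu e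
            ...   | inj₂ (inj₁ (inj₁ refl)) = no-bypass-M cc ux uy x≢y (inj₁ xa) (inj₁ yc) k
            ...   | inj₂ (inj₁ (inj₂ refl)) = no-bypass-M cc ux uy x≢y (inj₂ xa) (inj₁ yc) k
            ...   | inj₂ (inj₂ (inj₁ refl)) = no-bypass-M cc ux uy x≢y (inj₁ xu) (inj₁ yc) k
            ...   | inj₂ (inj₂ (inj₂ refl)) = no-bypass-M cc ux uy x≢y (inj₂ xu) (inj₁ yc) k
          -- Here `f` has no neighbour besides `x`, so a walk from `x` through uncovered vertices
          -- never leaves `x` and `f`. Then `y` is `f`, but `y` is internal and has a second
          -- neighbour.
          go (no ¬z) = at-y (stays (inj₁ refl) k)
            where
            f-nbr : ∀ {z} → f ~ z → z ≡ x
            f-nbr {z} fz with z ≟ x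
            ... | yes e  = e
            ... | no z≢x = ⊥-elim (¬z (z , fz , z≢x))
            stays : ∀ {z} → z ≡ x ⊎ z ≡ f → Walk (Uncovered M) z y → y ≡ x ⊎ y ≡ f
            stays h ε = h
            stays (inj₁ refl) ((_ , uz , e) ◅ w) = stays (inj₂ (one-free-nbr dx e uz xf uf)) w
            stays (inj₂ refl) ((_ , _ , e) ◅ w)  = stays (inj₁ (f-nbr e)) w
            at-y : y ≡ x ⊎ y ≡ f → ⊥
            at-y (inj₁ e)    = x≢y (≡-sym e)
            at-y (inj₂ refl) with another-nbr iy x
            ... | b , fb , b≢x = b≢x (f-nbr fb)

        initial-extendable : Extendable M
        initial-extendable = record { free-nbr = initial-free-nbr ; separated = initial-separated }

        saturate : Σ Matching λ M′ → M ⊑ M′ × Saturating M′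
        saturate = extend _ M ≤-refl initial-extendable

      saturate-none : Σ Matching Saturating
      saturate-none with saturate emptyMatching (λ cs → ⊥-elim (cs refl))
      ... | M , _ , sat = M , sat

      saturate-edge : ∀ {a b} → a ~ b → Σ Matching λ M → partner M a ≡ b × Saturating M
      saturate-edge {a} {b} ab with saturate M⁺ few
        where
        open AddEdge emptyMatching refl refl ab
        covered : ∀ {s} → ¬ Uncovered M⁺ s → s ≡ a ⊎ s ≡ b
        covered {s} cs with location s
        ... | inj₁ e = inj₁ e
        ... | inj₂ (inj₁ e) = inj₂ e
        ... | inj₂ (inj₂ (s≢a , s≢b)) = ⊥-elim (cs (uncovered⁺ refl s≢a s≢b))
        few : AtMostTwoEdges M⁺
        few cs ct cu with covered cs | covered ct
        ... | inj₁ refl | inj₁ refl = inj₁ (inj₁ refl)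
        ... | inj₁ refl | inj₂ refl = inj₁ (inj₂ (≡-sym at-w))
        ... | inj₂ refl | inj₁ refl = inj₁ (inj₂ (≡-sym at-r))
        ... | inj₂ refl | inj₂ refl = inj₁ (inj₁ refl)
      ... | M , ext , sat = M , trans (ext a (joined⇒covered M⁺ at-r ab)) at-r , sat
        where open AddEdge emptyMatching refl refl ab

      saturate-two-edges : ∀ {a b c d} → a ~ b → c ~ d → Disjoint a b c d →
                           Σ Matching λ M → partner M a ≡ b × partner M c ≡ d × Saturating M
      saturate-two-edges {a} {b} {c} {d} ab cd ((a≢c , a≢d) , (b≢c , b≢d)) = result (saturate M₂ few)
        where
        open AddEdge emptyMatching refl refl ab using () renaming (M⁺ to M₁; at-r to at-a; at-w to at-b)
        open AddEdge M₁ (AddEdge.uncovered⁺ emptyMatching refl refl ab refl (a≢c ∘ ≡-sym) (b≢c ∘ ≡-sym))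
                        (AddEdge.uncovered⁺ emptyMatching refl refl ab refl (a≢d ∘ ≡-sym) (b≢d ∘ ≡-sym)) cd
          using () renaming (M⁺ to M₂; at-r to at-c; at-w to at-d; elsewhere to not-cd; uncovered⁺ to uncovered₂)
        p = partner M₂
        pa : p a ≡ b
        pa = trans (not-cd a≢c a≢d) at-a
        pb : p b ≡ a
        pb = trans (not-cd b≢c b≢d) at-b
        same : V → V → Set
        same s t = s ≡ t ⊎ s ≡ p t
        covered : ∀ {s} → ¬ Uncovered M₂ s → (s ≡ a ⊎ s ≡ b) ⊎ (s ≡ c ⊎ s ≡ d)
        covered {s} cs with AddEdge.location emptyMatching refl refl ab s
                          | AddEdge.location emptyMatching refl refl cd s
        ... | inj₁ e | _ = inj₁ (inj₁ e)
        ... | inj₂ (inj₁ e) | _ = inj₁ (inj₂ e)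
        ... | inj₂ (inj₂ _) | inj₁ e = inj₂ (inj₁ e)
        ... | inj₂ (inj₂ _) | inj₂ (inj₁ e) = inj₂ (inj₂ e)
        ... | inj₂ (inj₂ (s≢a , s≢b)) | inj₂ (inj₂ (s≢c , s≢d)) =
          ⊥-elim (cs (uncovered₂ (AddEdge.uncovered⁺ emptyMatching refl refl ab refl s≢a s≢b) s≢c s≢d))
        same-edge : ∀ {x y s t} → p x ≡ y → p y ≡ x → (s ≡ x ⊎ s ≡ y) → (t ≡ x ⊎ t ≡ y) → same s t
        same-edge px py (inj₁ refl) (inj₁ refl) = inj₁ refl
        same-edge px py (inj₁ refl) (inj₂ refl) = inj₂ (≡-sym py)
        same-edge px py (inj₂ refl) (inj₁ refl) = inj₂ (≡-sym px)
        same-edge px py (inj₂ refl) (inj₂ refl) = inj₁ refl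
        few : AtMostTwoEdges M₂
        few cs ct cu with covered cs | covered ct | covered cu
        ... | inj₁ x | inj₁ y | _      = inj₁ (same-edge pa pb x y)
        ... | inj₂ x | inj₂ y | _      = inj₁ (same-edge at-c at-d x y)
        ... | inj₁ x | inj₂ _ | inj₁ z = inj₂ (inj₁ (same-edge pa pb x z))
        ... | inj₁ _ | inj₂ y | inj₂ z = inj₂ (inj₂ (same-edge at-c at-d y z))
        ... | inj₂ _ | inj₁ y | inj₁ z = inj₂ (inj₂ (same-edge pa pb y z))
        ... | inj₂ x | inj₁ _ | inj₂ z = inj₂ (inj₁ (same-edge at-c at-d x z))
        result : (Σ Matching λ M → M₂ ⊑ M × Saturating M) →
                 Σ Matching λ M → partner M a ≡ b × partner M c ≡ d × Saturating M
        result (M , ext , sat) = M , trans (ext a (joined⇒covered M₂ pa ab)) pa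
          , trans (ext c (joined⇒covered M₂ at-c cd)) at-c , sat

  -- Edge sets

  remove : EdgeSet G → V → V → EdgeSet G
  remove S a b i j = S i j ∧ not (⌊ i ≟ a ⌋ ∧ ⌊ j ≟ b ⌋)

  module _ (S : EdgeSet G) where

    remove-at : ∀ a b → remove S a b a b ≡ false
    remove-at a b rewrite ⌊⌋-true (a ≟ a) refl | ⌊⌋-true (b ≟ b) refl with S a b
    ... | true  = refl
    ... | false = refl

    remove-row : ∀ {a b i} j → i ≢ a → remove S a b i j ≡ S i j
    remove-row {a} {b} {i} j i≢a rewrite ⌊⌋-false (i ≟ a) i≢a with S i j
    ... | true  = refl
    ... | false = refl

    remove-col : ∀ {a b j} i → j ≢ b → remove S a b i j ≡ S i j
    remove-col {a} {b} {j} i j≢b rewrite ⌊⌋-false (j ≟ b) j≢b with ⌊ i ≟ a ⌋ | S i j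
    ... | true  | true  = refl
    ... | true  | false = refl
    ... | false | true  = refl
    ... | false | false = refl

    remove-other : ∀ {a b i j} → ¬ (a ≡ i × b ≡ j) → S i j ≡ true → remove S a b i j ≡ true
    remove-other {a} {b} {i} {j} h e with i ≟ a
    ... | no i≢a rewrite e = refl
    ... | yes refl with j ≟ b
    ...   | yes refl = ⊥-elim (h (refl , refl))
    ...   | no _ rewrite e = refl

    remove-true : ∀ {a b i j} → remove S a b i j ≡ true → S i j ≡ true × ¬ (a ≡ i × b ≡ j)
    remove-true e = proj₁ (∧-true e) , λ { (refl , refl) → true≢false e (remove-at _ _) }

    size-remove : ∀ {a b} → S a b ≡ true → sizeE G S ≡ suc (sizeE G (remove S a b))
    size-remove {a} {b} e = Σ-suc (n G) a
      (λ i i≢a → Σ-cong (n G) λ j → cong bit (≡-sym (remove-row j i≢a)))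
      (Σ-suc (n G) b (λ j j≢b → cong bit (≡-sym (remove-col a j≢b)))
        (trans (cong bit e) (cong (suc ∘ bit) (≡-sym (remove-at a b)))))

    size-zero : (∀ i j → S i j ≢ true) → sizeE G S ≡ 0
    size-zero h = Σ-zero (n G) λ i → Σ-zero (n G) λ j → cong bit (≢true⇒false (h i j))

    size-positive : 1 ≤ sizeE G S → ∃ λ a → ∃ λ b → S a b ≡ true
    size-positive h with Σ-positive (n G) h
    ... | a , h′ with Σ-positive (n G) h′
    ...   | b , h″ = a , b , bit-positive h″

    size-bound : sizeE G S ≤ n G * n G
    size-bound = Σ-bound (n G) λ i → ≤-trans (Σ-bound (n G) λ j → bit≤1 (S i j)) (≤-reflexive (*-identityʳ _))
      where
      Σ-bound : ∀ m {f : Fin m → ℕ} {b} → (∀ i → f i ≤ b) → ΣFinℕ m f ≤ m * b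
      Σ-bound zero    h = z≤n
      Σ-bound (suc m) h = +-mono-≤ (h fzero) (Σ-bound m (h ∘ fsuc))

  module _ {S : EdgeSet G} {a b : V} (ab : S a b ≡ true) where

    size≥1 : 1 ≤ sizeE G S
    size≥1 rewrite size-remove S ab = s≤s z≤n

    size≡1 : (∀ i j → S i j ≡ true → a ≡ i × b ≡ j) → sizeE G S ≡ 1
    size≡1 h = trans (size-remove S ab) (cong suc (size-zero (remove S a b) λ i j e →
      proj₂ (remove-true S e) (h i j (proj₁ (remove-true S e)))))

    module _ {c d : V} (cd : S c d ≡ true) (distinct : ¬ (a ≡ c × b ≡ d)) where

      size≥2 : 2 ≤ sizeE G S
      size≥2 rewrite size-remove S ab | size-remove (remove S a b) (remove-other S distinct cd) = s≤s (s≤s z≤n)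

      size≡2 : (∀ i j → S i j ≡ true → (a ≡ i × b ≡ j) ⊎ (c ≡ i × d ≡ j)) → sizeE G S ≡ 2
      size≡2 h = trans (size-remove S ab) (cong suc (trans (size-remove (remove S a b) cd′)
        (cong suc (size-zero (remove (remove S a b) c d) none))))
        where
        cd′ = remove-other S distinct cd
        none : ∀ i j → remove (remove S a b) c d i j ≢ true
        none i j e with remove-true (remove S a b) e
        ... | e′ , ≢cd with remove-true S e′
        ...   | e″ , ≢ab with h i j e″
        ...     | inj₁ x = ≢ab x
        ...     | inj₂ x = ≢cd x

  size≡2⁻ : ∀ S → sizeE G S ≡ 2 → ∃ λ a → ∃ λ b → ∃ λ c → ∃ λ d →
            S a b ≡ true × S c d ≡ true × ¬ (a ≡ c × b ≡ d) ×
            (∀ i j → S i j ≡ true → (a ≡ i × b ≡ j) ⊎ (c ≡ i × d ≡ j))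
  size≡2⁻ S h with size-positive S (subst (1 ≤_) (≡-sym h) (s≤s z≤n))
  ... | a , b , ab with suc-injective (trans (≡-sym (size-remove S ab)) h)
  ...   | h′ with size-positive (remove S a b) (subst (1 ≤_) (≡-sym h′) (s≤s z≤n))
  ...     | c , d , cd with suc-injective (trans (≡-sym (size-remove (remove S a b) cd)) h′)
  ...       | h″ = a , b , c , d , ab , proj₁ (remove-true S cd) , proj₂ (remove-true S cd) , only
    where
    only : ∀ i j → S i j ≡ true → (a ≡ i × b ≡ j) ⊎ (c ≡ i × d ≡ j)
    only i j e with (a ≟ i) ×-dec (b ≟ j) | (c ≟ i) ×-dec (d ≟ j)
    ... | yes x | _     = inj₁ x
    ... | no _  | yes x = inj₂ x
    ... | no x  | no y with subst (1 ≤_) h″ (size≥1 {remove (remove S a b) c d}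
      (remove-other (remove S a b) y (remove-other S x e)))
    ...   | ()

  isEdge⁺ : ∀ {i j} → toℕ i < toℕ j → i ~ j → isEdge G i j ≡ true
  isEdge⁺ {i} {j} i<j e = ∧-intro (Equivalence.to T-≡ (<⇒<ᵇ i<j)) e

  isEdge⁻ : ∀ {i j} → isEdge G i j ≡ true → toℕ i < toℕ j × i ~ j
  isEdge⁻ {i} {j} e = <ᵇ⇒< (toℕ i) (toℕ j) (Equivalence.from T-≡ (proj₁ (∧-true e))) , proj₂ (∧-true e)

  -- Edge sets store each edge with increasing ends; this forgets the orientation. As a data type,
  -- rather than a sum of equations, it lets `S`, `u` and `v` be inferred.
  data Has (S : EdgeSet G) (u v : V) : Set where
    fwd : S u v ≡ true → Has S u v
    bwd : S v u ≡ true → Has S u v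

  Has-sym : ∀ {S u v} → Has S u v → Has S v u
  Has-sym (fwd e) = bwd e
  Has-sym (bwd e) = fwd e

  Has⇒⊎ : ∀ {S u v} → Has S u v → S u v ≡ true ⊎ S v u ≡ true
  Has⇒⊎ (fwd e) = inj₁ e
  Has⇒⊎ (bwd e) = inj₂ e

  ⊎⇒Has : ∀ {S u v} → S u v ≡ true ⊎ S v u ≡ true → Has S u v
  ⊎⇒Has = [ fwd , bwd ]

  Has? : ∀ S u v → Dec (Has S u v)
  Has? S u v = map′ ⊎⇒Has Has⇒⊎
    ((S u v ≟ᵇ true) ⊎-dec (S v u ≟ᵇ true))

  Has-⊆ : ∀ {S T u v} → _⊆E_ G S T → Has S u v → Has T u v
  Has-⊆ h (fwd e) = fwd (h _ _ e)
  Has-⊆ h (bwd e) = bwd (h _ _ e)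

  Has⇒~ : ∀ {S u v} → SubE G S → Has S u v → u ~ v
  Has⇒~ sub (fwd e) = proj₂ (sub _ _ e)
  Has⇒~ sub (bwd e) = ~-sym (proj₂ (sub _ _ e))

  Has-unique : ∀ {M u v w} → IsMatching G M → Has M u v → Has M u w → v ≡ w
  Has-unique (_ , dis) (fwd e) (fwd f) = proj₂ (dis _ _ _ _ e f (inj₁ refl))
  Has-unique (_ , dis) (bwd e) (bwd f) = proj₁ (dis _ _ _ _ e f (inj₂ (inj₂ (inj₂ refl))))
  Has-unique (_ , dis) (fwd e) (bwd f) with dis _ _ _ _ e f (inj₂ (inj₁ refl))
  ... | refl , refl = refl
  Has-unique (_ , dis) (bwd e) (fwd f) with dis _ _ _ _ e f (inj₂ (inj₂ (inj₁ refl)))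
  ... | refl , refl = refl

  orient : ∀ {u v} → u ~ v → toℕ u < toℕ v ⊎ toℕ v < toℕ u
  orient {u} {v} uv with <-cmp (toℕ u) (toℕ v)
  ... | tri< a _ _ = inj₁ a
  ... | tri≈ _ b _ = ⊥-elim (~⇒≢ uv (toℕ-injective b))
  ... | tri> _ _ c = inj₂ c

  module _ {a b c d : V} (ab : a ~ b) (cd : c ~ d) (a<b : toℕ a < toℕ b) (c<d : toℕ c < toℕ d)
           (dis : Disjoint a b c d) where

    pairE : EdgeSet G
    pairE i j = ⌊ ((a ≟ i) ×-dec (b ≟ j)) ⊎-dec ((c ≟ i) ×-dec (d ≟ j)) ⌋

    pairE⁻ : ∀ i j → pairE i j ≡ true → (a ≡ i × b ≡ j) ⊎ (c ≡ i × d ≡ j)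
    pairE⁻ i j = ⌊⌋-holds (((a ≟ i) ×-dec (b ≟ j)) ⊎-dec ((c ≟ i) ×-dec (d ≟ j)))

    pairE⁺ : ∀ i j → (a ≡ i × b ≡ j) ⊎ (c ≡ i × d ≡ j) → pairE i j ≡ true
    pairE⁺ i j = ⌊⌋-true (((a ≟ i) ×-dec (b ≟ j)) ⊎-dec ((c ≟ i) ×-dec (d ≟ j)))

    pairE-sub : SubE G pairE
    pairE-sub i j e with pairE⁻ i j e
    ... | inj₁ (refl , refl) = a<b , ab
    ... | inj₂ (refl , refl) = c<d , cd

    pairE-matching : IsMatching G pairE
    pairE-matching = pairE-sub , λ i j k l e f → go (pairE⁻ i j e) (pairE⁻ k l f)
      where
      meet : ∀ {i j k l} → Disjoint i j k l → (i ≡ k ⊎ i ≡ l ⊎ j ≡ k ⊎ j ≡ l) → ⊥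
      meet ((h , _) , _) (inj₁ e) = h e
      meet ((_ , h) , _) (inj₂ (inj₁ e)) = h e
      meet (_ , (h , _)) (inj₂ (inj₂ (inj₁ e))) = h e
      meet (_ , (_ , h)) (inj₂ (inj₂ (inj₂ e))) = h e
      go : ∀ {i j k l} → (a ≡ i × b ≡ j) ⊎ (c ≡ i × d ≡ j) → (a ≡ k × b ≡ l) ⊎ (c ≡ k × d ≡ l) →
           (i ≡ k ⊎ i ≡ l ⊎ j ≡ k ⊎ j ≡ l) → i ≡ k × j ≡ l
      go (inj₁ (refl , refl)) (inj₁ (refl , refl)) _ = refl , refl
      go (inj₂ (refl , refl)) (inj₂ (refl , refl)) _ = refl , refl
      go (inj₁ (refl , refl)) (inj₂ (refl , refl)) m = ⊥-elim (meet dis m)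
      go (inj₂ (refl , refl)) (inj₁ (refl , refl)) m = ⊥-elim (meet (flip dis) m)
        where
        flip : ∀ {a b c d} → Disjoint a b c d → Disjoint c d a b
        flip ((ac , ad) , (bc , bd)) = (ac ∘ ≡-sym , bc ∘ ≡-sym) , (ad ∘ ≡-sym , bd ∘ ≡-sym)

    pairE-size : sizeE G pairE ≡ 2
    pairE-size = size≡2 (pairE⁺ a b (inj₁ (refl , refl))) (pairE⁺ c d (inj₂ (refl , refl)))
      (λ e → proj₁ (proj₁ dis) (proj₁ e)) pairE⁻

    pairE-2-matching : ∃ λ M → IsKMatching G 2 M × M a b ≡ true × M c d ≡ true
    pairE-2-matching = pairE , (pairE-matching , pairE-size) ,
      pairE⁺ a b (inj₁ (refl , refl)) , pairE⁺ c d (inj₂ (refl , refl))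

  pair-2-matching : ∀ {a b c d} → a ~ b → c ~ d → Disjoint a b c d →
                    ∃ λ M → IsKMatching G 2 M × Has M a b × Has M c d
  pair-2-matching ab cd dis@((ac , ad) , (bc , bd)) with orient ab | orient cd
  ... | inj₁ a<b | inj₁ c<d with pairE-2-matching ab cd a<b c<d dis
  ...   | M , m , e , f = M , m , fwd e , fwd f
  pair-2-matching ab cd dis@((ac , ad) , (bc , bd)) | inj₁ a<b | inj₂ d<c
    with pairE-2-matching ab (~-sym cd) a<b d<c ((ad , ac) , (bd , bc))
  ...   | M , m , e , f = M , m , fwd e , bwd f
  pair-2-matching ab cd dis@((ac , ad) , (bc , bd)) | inj₂ b<a | inj₁ c<d
    with pairE-2-matching (~-sym ab) cd b<a c<d ((bc , bd) , (ac , ad))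
  ...   | M , m , e , f = M , m , bwd e , fwd f
  pair-2-matching ab cd dis@((ac , ad) , (bc , bd)) | inj₂ b<a | inj₂ d<c
    with pairE-2-matching (~-sym ab) (~-sym cd) b<a d<c ((bd , bc) , (ad , ac))
  ...   | M , m , e , f = M , m , bwd e , bwd f

  -- Pairwise meeting edges form a star or a triangle, and a forest has no triangle. If neither end
  -- of the edge `ab` is a centre, an edge that misses `a` passes through `b` and one that misses
  -- `b` passes through `a`. Their other ends coincide, which gives a triangle, or differ, which
  -- makes the two edges disjoint.
  star-or-disjoint-edges : Forest G → ∀ T → SubE G T → NonEmptyE G T →
    (∃ λ v → ∀ i j → T i j ≡ true → v ≡ i ⊎ v ≡ j)
    ⊎ (∃ λ a → ∃ λ b → ∃ λ c → ∃ λ d → Has T a b × Has T c d × Disjoint a b c d)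
  star-or-disjoint-edges forest T sub (a , b , ab)
    with any? (λ a → any? λ b → any? λ c → any? λ d → Has? T a b ×-dec Has? T c d ×-dec Disjoint? a b c d)
  ... | yes found = inj₂ found
  ... | no none = inj₁ (center (avoiding a) (avoiding b))
    where
    Avoids : V → Set
    Avoids v = ∃ λ i → ∃ λ j → T i j ≡ true × v ≢ i × v ≢ j
    avoiding : ∀ v → Dec (Avoids v)
    avoiding v = any? λ i → any? λ j → (T i j ≟ᵇ true) ×-dec ¬? (v ≟ i) ×-dec ¬? (v ≟ j)
    centered : ∀ {v} → ¬ Avoids v → ∀ i j → T i j ≡ true → v ≡ i ⊎ v ≡ j
    centered {v} h i j e with v ≟ i | v ≟ j
    ... | yes x | _     = inj₁ x
    ... | no _  | yes y = inj₂ y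
    ... | no x  | no y  = ⊥-elim (h (i , j , e , x , y))
    other-end : ∀ {u v} → Has T u v → Avoids u → ∃ λ x → Has T v x × x ≢ u
    other-end {u} {v} uv (i , j , e , u≢i , u≢j) with v ≟ i | v ≟ j
    ... | yes refl | _        = j , fwd e , u≢j ∘ ≡-sym
    ... | no _     | yes refl = i , bwd e , u≢i ∘ ≡-sym
    ... | no v≢i   | no v≢j   = ⊥-elim (none (u , v , i , j , uv , fwd e , (u≢i , u≢j) , (v≢i , v≢j)))
    center : Dec (Avoids a) → Dec (Avoids b) → ∃ λ v → ∀ i j → T i j ≡ true → v ≡ i ⊎ v ≡ j
    center (no h) _ = a , centered h
    center (yes _) (no h) = b , centered h
    center (yes ha) (yes hb) with other-end (fwd ab) ha | other-end (bwd ab) hb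
    ... | x , bx , x≢a | y , ay , y≢b with x ≟ y
    ...   | yes refl = ⊥-elim (no-triangle forest (proj₂ (sub _ _ ab)) (Has⇒~ sub bx) (Has⇒~ sub ay))
    ...   | no x≢y = ⊥-elim (none (b , x , a , y , bx , ay ,
              ((~⇒≢ (proj₂ (sub _ _ ab)) ∘ ≡-sym , y≢b ∘ ≡-sym) , (x≢a , x≢y))))

  -- From matchings to edge sets

  module _ (M : Matching) where

    edges : EdgeSet G
    edges i j = isEdge G i j ∧ ⌊ partner M i ≟ j ⌋

    edges⁺ : ∀ {i j} → toℕ i < toℕ j → i ~ j → partner M i ≡ j → edges i j ≡ true
    edges⁺ {i} {j} i<j ij e = ∧-intro (isEdge⁺ i<j ij) (⌊⌋-true (partner M i ≟ j) e)

    edges⁻ : ∀ {i j} → edges i j ≡ true → toℕ i < toℕ j × i ~ j × partner M i ≡ j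
    edges⁻ {i} {j} e with ∧-true e
    ... | x , y = proj₁ (isEdge⁻ x) , proj₂ (isEdge⁻ x) , ⌊⌋-holds (partner M i ≟ j) y

    edges-sub : SubE G edges
    edges-sub i j e with edges⁻ e
    ... | i<j , ij , _ = i<j , ij

    Has-edges⁺ : ∀ {u v} → u ~ v → partner M u ≡ v → Has edges u v
    Has-edges⁺ {u} uv e with orient uv
    ... | inj₁ u<v = fwd (edges⁺ u<v uv e)
    ... | inj₂ v<u = bwd (edges⁺ v<u (~-sym uv) (trans (cong (partner M) (≡-sym e)) (invol M u)))

    Has-edges⁻ : ∀ {u v} → Has edges u v → partner M u ≡ v
    Has-edges⁻ (fwd e) = proj₂ (proj₂ (edges⁻ e))
    Has-edges⁻ {v = v} (bwd e) =
      trans (cong (partner M) (≡-sym (proj₂ (proj₂ (edges⁻ e))))) (invol M v)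

    edges-matching : IsMatching G edges
    edges-matching = edges-sub , dis
      where
      dis : ∀ a b c d → edges a b ≡ true → edges c d ≡ true →
            a ≡ c ⊎ a ≡ d ⊎ b ≡ c ⊎ b ≡ d → a ≡ c × b ≡ d
      dis a b c d e f (inj₁ refl) = refl , trans (≡-sym (Has-edges⁻ (fwd e))) (Has-edges⁻ (fwd f))
      dis a b c d e f (inj₂ (inj₂ (inj₂ refl))) =
        trans (≡-sym (Has-edges⁻ (bwd e))) (Has-edges⁻ (bwd f)) , refl
      dis a b c d e f (inj₂ (inj₁ refl)) with trans (≡-sym (Has-edges⁻ (fwd e))) (Has-edges⁻ (bwd f))
      ... | refl = ⊥-elim (<-asym (proj₁ (edges⁻ e)) (proj₁ (edges⁻ f)))
      dis a b c d e f (inj₂ (inj₂ (inj₁ refl))) with trans (≡-sym (Has-edges⁻ (bwd e))) (Has-edges⁻ (fwd f))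
      ... | refl = ⊥-elim (<-asym (proj₁ (edges⁻ e)) (proj₁ (edges⁻ f)))

    edges-perfect-internal : NoIsolated G → Saturating M → PerfectInternal G edges
    edges-perfect-internal ni sat = edges-matching , uncovered
      where
      uncovered : ∀ v → ¬ Covered G edges v → deg G v ≡ 1
      uncovered v h with Uncovered? M v
      ... | yes uv = deg<2⇒deg≡1 ni (proj₁ (sat v uv))
      ... | no cv  = ⊥-elim (h (partner M v , Has⇒⊎ (Has-edges⁺ (joined M cv) refl)))

  -- Extending 2-matchings and the P₅ condition

  P5⇒B : Forest G → NoIsolated G → P5Constrained G → CondB G
  P5⇒B forest ni p5 M ((sub , dis) , size) = extension (size≡2⁻ M size)
    where
    extension : _ → ExtendsToPIM G M
    extension (a , b , c , d , ab , cd , distinct , only) =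
      saturated (saturate-two-edges forest p5 (proj₂ (sub _ _ ab)) (proj₂ (sub _ _ cd)) disjoint)
      where
      disjoint : Disjoint a b c d
      disjoint = (distinct ∘ dis a b c d ab cd ∘ inj₁ , distinct ∘ dis a b c d ab cd ∘ inj₂ ∘ inj₁)
        , (distinct ∘ dis a b c d ab cd ∘ inj₂ ∘ inj₂ ∘ inj₁ , distinct ∘ dis a b c d ab cd ∘ inj₂ ∘ inj₂ ∘ inj₂)
      saturated : (Σ Matching λ N → partner N a ≡ b × partner N c ≡ d × Saturating N) → ExtendsToPIM G M
      saturated (N , pa , pc , sat) = edges N , included , edges-perfect-internal N ni sat
        where
        included : _⊆E_ G M (edges N)
        included i j e with sub i j e | only i j e
        ... | i<j , ij | inj₁ (refl , refl) = edges⁺ N i<j ij pa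
        ... | i<j , ij | inj₂ (refl , refl) = edges⁺ N i<j ij pc

  record P5 : Set where
    field
      {a b c d e} : V
      ab  : a ~ b
      bc  : b ~ c
      cd  : c ~ d
      de  : d ~ e
      distinct : Unique (a ∷ b ∷ c ∷ d ∷ e ∷ [])

  P5-constrained : (∀ (p : P5) → 3 ≤ deg G (P5.c p)) → P5Constrained G
  P5-constrained h f inj steps = h record
    { ab = steps fzero ; bc = steps (fsuc fzero) ; cd = steps (fsuc (fsuc fzero))
    ; de = steps (fsuc (fsuc (fsuc fzero)))
    ; distinct = map⁺ (inj _ _) (allFin⁺ 5) }

  B⇒P5 : CondB G → P5Constrained G
  B⇒P5 ext = P5-constrained λ p → decidable-stable (3 ≤? _) (go p)
    where
    go : (p : P5) → ¬ ¬ 3 ≤ deg G (P5.c p)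
    go record { a = a ; b = b ; c = c ; d = d ; e = e ; ab = ab ; bc = bc ; cd = cd ; de = de
              ; distinct = (a≢b ∷ a≢c ∷ a≢d ∷ a≢e ∷ []) ∷ (b≢c ∷ b≢d ∷ b≢e ∷ []) ∷ (c≢d ∷ c≢e ∷ []) ∷ _ } h
      with pair-2-matching ab de ((a≢d , a≢e) , (b≢d , b≢e))
    ... | M , m , Mab , Mde with ext M m
    ...   | M′ , M⊆M′ , mat , internal = <⇒≢ (2≤deg (~-sym bc) cd b≢d) (≡-sym (internal c uncovered))
      where
      uncovered : ¬ Covered G M′ c
      uncovered (u , cu′) with ⊎⇒Has {M′} {c} {u} cu′ | u ≟ b | u ≟ d
      ... | cu | yes refl | _ = a≢c (Has-unique mat
        (Has-⊆ M⊆M′ (Has-sym Mab)) (Has-sym cu))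
      ... | cu | no _ | yes refl = c≢e (Has-unique mat (Has-sym cu) (Has-⊆ M⊆M′ Mde))
      ... | cu | no u≢b | no u≢d =
        h (3≤deg (~-sym bc) cd (Has⇒~ (proj₁ mat) cu) b≢d (u≢b ∘ ≡-sym) (u≢d ∘ ≡-sym))

  -- Maximal stars

  star⁺ : ∀ {v i j} → toℕ i < toℕ j → i ~ j → v ≡ i ⊎ v ≡ j → starE G v i j ≡ true
  star⁺ {v} {i} {j} i<j ij (inj₁ e) = ∧-intro (isEdge⁺ i<j ij) (∨-introˡ (⌊⌋-true (i ≟ v) (≡-sym e)))
  star⁺ {v} {i} {j} i<j ij (inj₂ e) = ∧-intro (isEdge⁺ i<j ij) (∨-introʳ (⌊⌋-true (j ≟ v) (≡-sym e)))

  star-sub : ∀ v → SubE G (starE G v)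
  star-sub v i j e = isEdge⁻ (proj₁ (∧-true e))

  star⁻ : ∀ {v i j} → starE G v i j ≡ true → v ≡ i ⊎ v ≡ j
  star⁻ {v} {i} {j} e with ∨-true (proj₂ (∧-true {isEdge G i j} e))
  ... | inj₁ x = inj₁ (≡-sym (⌊⌋-holds (i ≟ v) x))
  ... | inj₂ x = inj₂ (≡-sym (⌊⌋-holds (j ≟ v) x))

  Has-star : ∀ {v u w} → u ~ w → v ≡ u ⊎ v ≡ w → Has (starE G v) u w
  Has-star uw h with orient uw
  ... | inj₁ u<w = fwd (star⁺ u<w uw h)
  Has-star uw (inj₁ e) | inj₂ w<u = bwd (star⁺ w<u (~-sym uw) (inj₂ e))
  Has-star uw (inj₂ e) | inj₂ w<u = bwd (star⁺ w<u (~-sym uw) (inj₁ e))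

  Has-star⁻ : ∀ {v u w} → Has (starE G v) u w → v ≡ u ⊎ v ≡ w
  Has-star⁻ (fwd e) = star⁻ e
  Has-star⁻ (bwd e) = swap (star⁻ e)

  Has⇒nonempty : ∀ {S u v} → Has S u v → NonEmptyE G S
  Has⇒nonempty (fwd e) = _ , _ , e
  Has⇒nonempty (bwd e) = _ , _ , e

  star-nonempty : ∀ {v u} → v ~ u → NonEmptyE G (starE G v)
  star-nonempty {v} vu = Has⇒nonempty (Has-star {v} vu (inj₁ refl))

  star-not-proper : ∀ v → ¬ ProperSub G (starE G v) (starE G v)
  star-not-proper v (_ , _ , _ , e , f) = true≢false e f

  -- A star that contains two edges at `v` with different other ends can only be rooted at `v`.
  internal⇒maximal : ∀ {v} → 2 ≤ deg G v → MaximalStarAt G v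
  internal⇒maximal {v} h with two-nbrs h
  ... | a , b , va , vb , a≢b = star-nonempty va , λ { (u , sub) → bigger u sub }
    where
    bigger : ∀ u → ¬ ProperSub G (starE G v) (starE G u)
    bigger u (sub , proper) with Has-star⁻ {u} (Has-⊆ {starE G v} sub (Has-star va (inj₁ refl)))
                               | Has-star⁻ {u} (Has-⊆ {starE G v} sub (Has-star vb (inj₁ refl)))
    ... | inj₁ refl | _         = star-not-proper u (sub , proper)
    ... | inj₂ _    | inj₁ refl = star-not-proper u (sub , proper)
    ... | inj₂ e    | inj₂ f    = a≢b (trans (≡-sym e) f)

  isolated-edge⇒maximal : ∀ {u v} → u ~ v → deg G u < 2 → deg G v < 2 → MaximalStarAt G u
  isolated-edge⇒maximal {u} {v} uv leaf-u leaf-v = star-nonempty uv , λ { (x , sub) → bigger x sub }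
    where
    bigger : ∀ x → ¬ ProperSub G (starE G u) (starE G x)
    bigger x (sub , i , j , e , f) with Has-star⁻ {x} (Has-⊆ {starE G u} sub (Has-star uv (inj₁ refl)))
    ... | inj₁ refl = star-not-proper x (sub , i , j , e , f)
    ... | inj₂ refl with star-sub x i j e | star⁻ {x} {i} {j} e
    ...   | i<j , ij | inj₁ refl = true≢false
            (star⁺ i<j ij (inj₂ (deg<2⇒unique-nbr leaf-v (~-sym uv) ij))) f
    ...   | i<j , ij | inj₂ refl = true≢false
            (star⁺ i<j ij (inj₁ (deg<2⇒unique-nbr leaf-v (~-sym uv) (~-sym ij)))) f

  -- The star of a leaf is a single edge and lies in the star of its neighbour, properly so if the
  -- neighbour is internal. Hence the only leaves with a maximal star are the ends of isolated
  -- edges.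
  maximal-leaf : ∀ {v u} → MaximalStarAt G v → deg G v < 2 → v ~ u → deg G u < 2
  maximal-leaf {v} {u} (_ , not-proper) leaf vu = ≰⇒> λ internal → not-proper (u , included , proper internal)
    where
    included : _⊆E_ G (starE G v) (starE G u)
    included i j e with star-sub v i j e | star⁻ {v} {i} {j} e
    ... | i<j , ij | inj₁ refl = star⁺ i<j ij (inj₂ (deg<2⇒unique-nbr leaf vu ij))
    ... | i<j , ij | inj₂ refl = star⁺ i<j ij (inj₁ (deg<2⇒unique-nbr leaf vu (~-sym ij)))
    outside : ∀ {x} → x ≢ v → u ~ x → ∀ {i j} → (v ≡ i ⊎ v ≡ j) → ¬ ((u ≡ i × x ≡ j) ⊎ (u ≡ j × x ≡ i))
    outside x≢v ux (inj₁ refl) (inj₁ (refl , _)) = ~⇒≢ vu refl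
    outside x≢v ux (inj₁ refl) (inj₂ (_ , refl)) = x≢v refl
    outside x≢v ux (inj₂ refl) (inj₁ (_ , refl)) = x≢v refl
    outside x≢v ux (inj₂ refl) (inj₂ (refl , _)) = ~⇒≢ vu refl
    proper : 2 ≤ deg G u → ∃ λ i → ∃ λ j → starE G u i j ≡ true × starE G v i j ≡ false
    proper internal with another-nbr internal v
    ... | x , ux , x≢v with Has-star {u} ux (inj₁ refl)
    ...   | fwd e = u , x , e , ≢true⇒false λ f → outside x≢v ux (star⁻ {v} {u} {x} f) (inj₁ (refl , refl))
    ...   | bwd e = x , u , e , ≢true⇒false λ f → outside x≢v ux (star⁻ {v} {x} {u} f) (inj₂ (refl , refl))

  -- An uncovered root would be a leaf on an isolated edge. Its neighbour is covered, hence by a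
  -- second edge, which contradicts the isolation.
  maximal⇒covered : NoIsolated G → ∀ M {v} → Saturating M → MaximalStarAt G v → ¬ Uncovered M v
  maximal⇒covered ni M {v} sat max uv with ni v | sat v uv
  ... | u , vu | leaf , nbrs-covered = <⇒≱ (maximal-leaf max leaf vu)
    (2≤deg (~-sym vu) (joined M (nbrs-covered u vu)) λ e →
      ~⇒≢ vu (trans (≡-sym uv) (trans (cong (partner M) e) (invol M u))))

  -- Weights and the obstruction at a middle vertex of degree 2

  pick : Bool → ℚ → ℚ
  pick b q = if b then q else 0ℚ

  weight-+ : ∀ φ {S T S′ T′ : EdgeSet G} →
    (∀ i j → pick (S i j) (φ i j) ℚ.+ pick (T i j) (φ i j) ≡ pick (S′ i j) (φ i j) ℚ.+ pick (T′ i j) (φ i j)) →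
    weight G φ S ℚ.+ weight G φ T ≡ weight G φ S′ ℚ.+ weight G φ T′
  weight-+ φ {S} {T} {S′} {T′} h = trans (≡-sym (split S T)) (trans
    (Σℚ-cong (n G) λ i → Σℚ-cong (n G) (h i)) (split S′ T′))
    where
    row : EdgeSet G → V → ℚ
    row A i = ΣFinℚ (n G) λ j → pick (A i j) (φ i j)
    split : ∀ A B → ΣFinℚ (n G) (λ i → ΣFinℚ (n G) λ j → pick (A i j) (φ i j) ℚ.+ pick (B i j) (φ i j))
                    ≡ weight G φ A ℚ.+ weight G φ B
    split A B = trans (Σℚ-cong (n G) λ i → Σℚ-+ (n G) (λ j → pick (A i j) (φ i j)) (λ j → pick (B i j) (φ i j)))
      (Σℚ-+ (n G) (row A) (row B))

  -- The identity behind the obstruction at a single pair of vertices: `x`, `y` and `z` tell whether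
  -- the pair lies in the stars of `b`, `d` and `c`. The first two stars share nothing and together
  -- cover the third.
  exchange : ∀ {x y z} q → (x ≡ true → y ≡ true → ⊥) → (z ≡ true → x ≡ true ⊎ y ≡ true) →
             pick ((x ∨ y) ∧ not z) q ℚ.+ pick z q ≡ pick x q ℚ.+ pick y q
  exchange {true}  {true}          q h k = ⊥-elim (h refl refl)
  exchange {true}  {false} {true}  q h k = ℚ.+-comm 0ℚ q
  exchange {true}  {false} {false} q h k = refl
  exchange {false} {true}  {true}  q h k = refl
  exchange {false} {true}  {false} q h k = ℚ.+-comm q 0ℚ
  exchange {false} {false} {true}  q h k with k refl
  ... | inj₁ ()
  ... | inj₂ ()
  exchange {false} {false} {false} q h k = refl


  Normalised : (V → V → ℚ) → Set
  Normalised φ = ∀ S → SubE G S → IsMaximalStar G S → weight G φ S ≡ 1ℚ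

  module _ (forest : Forest G) {a b c d e : V} (ab : a ~ b) (bc : b ~ c) (cd : c ~ d) (de : d ~ e)
           (a≢c : a ≢ c) (a≢d : a ≢ d) (a≢e : a ≢ e) (b≢d : b ≢ d) (b≢e : b ≢ e) (c≢e : c ≢ e)
           (small : ¬ 3 ≤ deg G c) where

    obstruction : EdgeSet G
    obstruction i j = (starE G b i j ∨ starE G d i j) ∧ not (starE G c i j)

    obstruction-sub : SubE G obstruction
    obstruction-sub i j h with ∨-true {starE G b i j} (proj₁ (∧-true h))
    ... | inj₁ x = star-sub b i j x
    ... | inj₂ x = star-sub d i j x

    obstruction⁺ : ∀ {u w x} → Has (starE G x) u w → x ≡ b ⊎ x ≡ d → c ≢ u → c ≢ w → Has obstruction u w
    obstruction⁺ {u} {w} {x} h x∈ c≢u c≢w = go h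
      where
      not-c : ∀ {i j} → c ≢ i → c ≢ j → not (starE G c i j) ≡ true
      not-c {i} {j} c≢i c≢j = cong not (≢true⇒false {starE G c i j} (λ f → neither (star⁻ {c} {i} {j} f)))
        where
        neither : c ≡ i ⊎ c ≡ j → ⊥
        neither (inj₁ e) = c≢i e
        neither (inj₂ e) = c≢j e
      either : ∀ i j → x ≡ b ⊎ x ≡ d → starE G x i j ≡ true → starE G b i j ∨ starE G d i j ≡ true
      either i j (inj₁ refl) e = ∨-introˡ e
      either i j (inj₂ refl) e = ∨-introʳ {starE G b i j} e
      go : Has (starE G x) u w → Has obstruction u w
      go (fwd e) = fwd (∧-intro (either u w x∈ e) (not-c c≢u c≢w))
      go (bwd e) = bwd (∧-intro (either w u x∈ e) (not-c c≢w c≢u))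

    has-ab : Has obstruction a b
    has-ab = obstruction⁺ (Has-star {b} ab (inj₂ refl)) (inj₁ refl) (a≢c ∘ ≡-sym) (~⇒≢ bc ∘ ≡-sym)

    has-de : Has obstruction d e
    has-de = obstruction⁺ (Has-star {d} de (inj₁ refl)) (inj₂ refl) (~⇒≢ cd) c≢e

    obstruction-nonempty : NonEmptyE G obstruction
    obstruction-nonempty = Has⇒nonempty has-ab

    -- It contains the disjoint edges `ab` and `de`, and no vertex lies on both.
    obstruction-not-star : ¬ IsMaximalStar G obstruction
    obstruction-not-star (u , _ , same) with Has-star⁻ {u} (Has-⊆ {obstruction} included has-ab)
                                           | Has-star⁻ {u} (Has-⊆ {obstruction} included has-de)
      where
      included : _⊆E_ G obstruction (starE G u)
      included i j h = trans (≡-sym (same i j)) h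
    ... | inj₁ refl | inj₁ x = a≢d x
    ... | inj₁ refl | inj₂ x = a≢e x
    ... | inj₂ refl | inj₁ x = b≢d x
    ... | inj₂ refl | inj₂ x = b≢e x

    -- A common edge would join `b` to `d` and close a triangle with `c`.
    not-in-both : ∀ i j → starE G b i j ≡ true → starE G d i j ≡ true → ⊥
    not-in-both i j x y with star⁻ {b} {i} {j} x | star⁻ {d} {i} {j} y
    ... | inj₁ refl | inj₁ z    = b≢d (≡-sym z)
    ... | inj₂ refl | inj₂ z    = b≢d (≡-sym z)
    ... | inj₁ refl | inj₂ refl = no-triangle forest bc cd (proj₂ (star-sub b i j x))
    ... | inj₂ refl | inj₁ refl = no-triangle forest bc cd (~-sym (proj₂ (star-sub b i j x)))

    middle-nbr : ∀ {u} → c ~ u → b ≡ u ⊎ d ≡ u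
    middle-nbr {u} cu with b ≟ u | d ≟ u
    ... | yes x | _     = inj₁ x
    ... | no _  | yes x = inj₂ x
    ... | no x  | no y  = ⊥-elim (small (3≤deg (~-sym bc) cd cu b≢d x y))

    middle-star : ∀ i j → starE G c i j ≡ true → starE G b i j ≡ true ⊎ starE G d i j ≡ true
    middle-star i j x with star-sub c i j x | star⁻ {c} {i} {j} x
    ... | i<j , ij | inj₁ refl with middle-nbr ij
    ...   | inj₁ z = inj₁ (star⁺ i<j ij (inj₂ z))
    ...   | inj₂ z = inj₂ (star⁺ i<j ij (inj₂ z))
    middle-star i j x | i<j , ij | inj₂ refl with middle-nbr (~-sym ij)
    ...   | inj₁ z = inj₁ (star⁺ i<j ij (inj₁ z))
    ...   | inj₂ z = inj₂ (star⁺ i<j ij (inj₁ z))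

    obstruction-weight : ∀ φ → Normalised φ → weight G φ obstruction ≡ 1ℚ
    obstruction-weight φ norm = +-cancelʳ 1ℚ _ _ (begin
      weight G φ obstruction ℚ.+ 1ℚ
        ≡⟨ cong (weight G φ obstruction ℚ.+_) (≡-sym (star-weight c (~-sym bc) cd b≢d)) ⟩
      weight G φ obstruction ℚ.+ weight G φ (starE G c)
        ≡⟨ weight-+ φ {obstruction} {starE G c} {starE G b} {starE G d} (λ i j →
             exchange (φ i j) (not-in-both i j) (middle-star i j)) ⟩
      weight G φ (starE G b) ℚ.+ weight G φ (starE G d)
        ≡⟨ cong₂ ℚ._+_ (star-weight b (~-sym ab) bc a≢c) (star-weight d (~-sym cd) de c≢e) ⟩
      1ℚ ℚ.+ 1ℚ ∎)
      where
      open ≡-Reasoning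
      open import Algebra.Properties.AbelianGroup ℚ.+-0-abelianGroup using () renaming (∙-cancelʳ to +-cancelʳ)
      star-weight : ∀ v {x y} → v ~ x → v ~ y → x ≢ y → weight G φ (starE G v) ≡ 1ℚ
      star-weight v vx vy x≢y = norm (starE G v) (star-sub v)
        (v , internal⇒maximal (2≤deg vx vy x≢y) , λ _ _ → refl)

  -- A common consequence of (c) and (d). From (c) the weighting depends on `T` and γ is taken to be
  -- 1; from (d) one weighting serves every `T`.
  WeightsDistinguishStars : Set
  WeightsDistinguishStars = ∀ T → SubE G T → NonEmptyE G T → ¬ IsMaximalStar G T →
    ∃ λ φ → Normalised φ × weight G φ T ≢ 1ℚ

  distinguish⇒P5 : Forest G → WeightsDistinguishStars → P5Constrained G
  distinguish⇒P5 forest dist = P5-constrained λ p → decidable-stable (3 ≤? _) (go p)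
    where
    go : (p : P5) → ¬ ¬ 3 ≤ deg G (P5.c p)
    go record { ab = ab ; bc = bc ; cd = cd ; de = de
              ; distinct = (a≢b ∷ a≢c ∷ a≢d ∷ a≢e ∷ []) ∷ (b≢c ∷ b≢d ∷ b≢e ∷ []) ∷ (c≢d ∷ c≢e ∷ []) ∷ _ } small
      = contradict (dist T (obstruction-sub forest ab bc cd de a≢c a≢d a≢e b≢d b≢e c≢e small)
          (obstruction-nonempty forest ab bc cd de a≢c a≢d a≢e b≢d b≢e c≢e small)
          (obstruction-not-star forest ab bc cd de a≢c a≢d a≢e b≢d b≢e c≢e small))
      where
      T = obstruction forest ab bc cd de a≢c a≢d a≢e b≢d b≢e c≢e small
      contradict : (∃ λ φ → Normalised φ × weight G φ T ≢ 1ℚ) → ⊥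
      contradict (φ , norm , w≢1) =
        w≢1 (obstruction-weight forest ab bc cd de a≢c a≢d a≢e b≢d b≢e c≢e small φ norm)

  strongly⇒P5 : Forest G → StronglyEquistarable G → P5Constrained G
  strongly⇒P5 forest (_ , strong) = distinguish⇒P5 forest distinguish
    where
    distinguish : WeightsDistinguishStars
    distinguish T sub ne not-star with strong T sub ne not-star 1ℚ ℚ.≤-refl
    ... | φ , _ , norm , w≢1 = φ , norm , w≢1

  equistarable⇒P5 : Forest G → Equistarable G → P5Constrained G
  equistarable⇒P5 forest (_ , φ , _ , iff) = distinguish⇒P5 forest λ T sub _ not-star →
    φ , (λ S sub′ → Equivalence.to (iff S sub′)) , λ w≡1 → not-star (Equivalence.from (iff T sub) w≡1)

  -- Edges shared with a matching

  hits : Matching → EdgeSet G → ℕ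
  hits M T = sizeE G (λ i j → T i j ∧ edges M i j)

  common : ∀ {M T u v} → SubE G T → Has T u v → partner M u ≡ v →
           Has (λ i j → T i j ∧ edges M i j) u v
  common {M} sub (fwd e) pu with sub _ _ e
  ... | i<j , ij = fwd (∧-intro e (edges⁺ M i<j ij pu))
  common {M} {u = u} sub (bwd e) pu with sub _ _ e
  ... | i<j , ij = bwd (∧-intro e (edges⁺ M i<j ij (trans (cong (partner M) (≡-sym pu)) (invol M u))))

  Centered : V → EdgeSet G → Set
  Centered v T = ∀ i j → T i j ≡ true → v ≡ i ⊎ v ≡ j

  meet-at : ∀ {v i j k l : V} → v ≡ i ⊎ v ≡ j → v ≡ k ⊎ v ≡ l → i ≡ k ⊎ i ≡ l ⊎ j ≡ k ⊎ j ≡ l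
  meet-at (inj₁ refl) (inj₁ e) = inj₁ e
  meet-at (inj₁ refl) (inj₂ e) = inj₂ (inj₁ e)
  meet-at (inj₂ refl) (inj₁ e) = inj₂ (inj₂ (inj₁ e))
  meet-at (inj₂ refl) (inj₂ e) = inj₂ (inj₂ (inj₂ e))

  hits≡1 : ∀ M {T v u w} → Centered v T → Has (λ i j → T i j ∧ edges M i j) u w → hits M T ≡ 1
  hits≡1 M {T} {v} center = λ { (fwd e) → one e ; (bwd e) → one e }
    where
    one : ∀ {i j} → T i j ∧ edges M i j ≡ true → hits M T ≡ 1
    one {i} {j} e = size≡1 e λ k l f → proj₂ (edges-matching M) i j k l
      (proj₂ (∧-true {T i j} e)) (proj₂ (∧-true {T k l} f))
      (meet-at (center i j (proj₁ (∧-true e))) (center k l (proj₁ (∧-true f))))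

  maximal-star-hits : NoIsolated G → ∀ M → Saturating M → ∀ S → SubE G S → IsMaximalStar G S → hits M S ≡ 1
  maximal-star-hits ni M sat S sub (v , max , same) =
    hits≡1 M (λ i j e → star⁻ {v} {i} {j} (trans (≡-sym (same i j)) e))
      (common {M} sub (Has-⊆ (λ i j e → trans (same i j) e) (Has-star {v} (joined M covered) (inj₁ refl))) refl)
    where
    covered : ¬ Uncovered M v
    covered = maximal⇒covered ni M sat max

  -- In either case, for each γ ≤ 1 some indicator of a matching in F gives T a weight other than γ.
  Detected : (Matching → Set) → EdgeSet G → Set
  Detected F T = (∃ λ M → F M × 2 ≤ hits M T) ⊎
                 ((∃ λ M → F M × hits M T ≡ 1) × (∃ λ M → F M × hits M T ≡ 0))

  module _ (forest : Forest G) (F : Matching → Set)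
           (edge-in : ∀ {a b} → a ~ b → ∃ λ M → F M × partner M a ≡ b)
           (pair-in : ∀ {a b c d} → a ~ b → c ~ d → Disjoint a b c d →
                      ∃ λ M → F M × partner M a ≡ b × partner M c ≡ d) where

    -- `F` is kept abstract because it is instantiated twice: by all saturating matchings for strong
    -- equistarability, and by the members of a finite list for equistarability.
    detect : ∀ T → SubE G T → NonEmptyE G T → IsMaximalStar G T ⊎ Detected F T
    detect T sub ne@(a , b , Tab) = [ center , pair ] (star-or-disjoint-edges forest T sub ne)
      where
      ab : a ~ b
      ab = proj₂ (sub a b Tab)

      pair : (∃ λ a → ∃ λ b → ∃ λ c → ∃ λ d → Has T a b × Has T c d × Disjoint a b c d) →
             IsMaximalStar G T ⊎ Detected F T
      pair (a , b , c , d , Tab , Tcd , dis) with pair-in (Has⇒~ sub Tab) (Has⇒~ sub Tcd) dis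
      ... | M , FM , pa , pc = inj₂ (inj₁ (M , FM , two (common {M} sub Tab pa) (common {M} sub Tcd pc) dis))
        where
        two : ∀ {S a b c d} → Has S a b → Has S c d → Disjoint a b c d → 2 ≤ sizeE G S
        two (fwd e) (fwd f) dis = size≥2 e f (proj₁ (proj₁ dis) ∘ proj₁)
        two (fwd e) (bwd f) dis = size≥2 e f (proj₂ (proj₁ dis) ∘ proj₁)
        two (bwd e) (fwd f) dis = size≥2 e f (proj₁ (proj₂ dis) ∘ proj₁)
        two (bwd e) (bwd f) dis = size≥2 e f (proj₂ (proj₂ dis) ∘ proj₁)

      maximal-center : ∀ v → MaximalStarAt G v → Centered v T → IsMaximalStar G T ⊎ Detected F T
      maximal-center v max center = missing? (any? λ i → any? λ j → (starE G v i j ≟ᵇ true) ×-dec ¬? (T i j ≟ᵇ true))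
        where
        missing? : Dec (∃ λ i → ∃ λ j → starE G v i j ≡ true × T i j ≢ true) → IsMaximalStar G T ⊎ Detected F T
        missing? (no none) = inj₁ (v , max , λ i j → bool-ext
          (λ e → star⁺ (proj₁ (sub i j e)) (proj₂ (sub i j e)) (center i j e))
          (λ e → decidable-stable (T i j ≟ᵇ true) λ h → none (i , j , e , h)))
        -- `M` contains an edge of `T`, and `N` contains the edge `ij` of the star that `T` lacks.
        -- Every edge of `T` meets `ij` at `v`, so `N` contains none of them.
        missing? (yes (i , j , e , h)) with edge-in ab | edge-in (proj₂ (star-sub v i j e))
        ... | M , FM , pa | N , FN , pi = inj₂ (inj₂
          ( (M , FM , hits≡1 M center (common {M} sub (fwd Tab) pa))
          , (N , FN , size-zero _ λ k l f → h (subst (λ (k , l) → T k l ≡ true)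
              (same k l (proj₁ (∧-true f)) (proj₂ (∧-true {T k l} f))) (proj₁ (∧-true f))))))
          where
          ij∈N : edges N i j ≡ true
          ij∈N = edges⁺ N (proj₁ (star-sub v i j e)) (proj₂ (star-sub v i j e)) pi
          same : ∀ k l → T k l ≡ true → edges N k l ≡ true → (k , l) ≡ (i , j)
          same k l Tkl kl with proj₂ (edges-matching N) k l i j kl ij∈N (meet-at (center k l Tkl) (star⁻ {v} {i} {j} e))
          ... | refl , refl = refl

      center : (∃ λ v → Centered v T) → IsMaximalStar G T ⊎ Detected F T
      center (v , c) with 2 ≤? deg G v
      ... | yes internal = maximal-center v (internal⇒maximal internal) c
      ... | no leaf = at-leaf other-end
        where
        other-end : ∃ λ u → v ~ u
        other-end with c a b Tab
        ... | inj₁ refl = b , ab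
        ... | inj₂ refl = a , ~-sym ab
        at-leaf : (∃ λ u → v ~ u) → IsMaximalStar G T ⊎ Detected F T
        at-leaf (u , vu) with 2 ≤? deg G u
        ... | no leaf-u = maximal-center v (isolated-edge⇒maximal vu (≰⇒> leaf) (≰⇒> leaf-u)) c
        -- All edges of `T` pass through the leaf `v`, so each is the edge from `v` to `u`. Thus `u`
        -- is a centre too, and its star is maximal.
        ... | yes internal = maximal-center u (internal⇒maximal internal) recentered
          where
          recentered : Centered u T
          recentered i j e with c i j e
          ... | inj₁ refl = inj₂ (deg<2⇒unique-nbr (≰⇒> leaf) vu (proj₂ (sub i j e)))
          ... | inj₂ refl = inj₁ (deg<2⇒unique-nbr (≰⇒> leaf) vu (~-sym (proj₂ (sub i j e))))

  -- Weightings built from matchings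

  natWeight : (V → V → ℕ) → EdgeSet G → ℕ
  natWeight m S = ΣFinℕ (n G) λ i → ΣFinℕ (n G) λ j → if S i j then m i j else 0

  -- Both weightings constructed below are natural numbers times a common rational factor, so their
  -- sums are computed in ℕ and carried to ℚ here.
  weight-ι : ∀ q m S → weight G (λ i j → q ℚ.* ι (m i j)) S ≡ q ℚ.* ι (natWeight m S)
  weight-ι q m S = trans
    (Σℚ-cong (n G) λ i → trans (Σℚ-cong (n G) λ j → entry (S i j) (m i j)) (Σ-ι (n G) q _))
    (Σ-ι (n G) q _)
    where
    entry : ∀ b k → pick b (q ℚ.* ι k) ≡ q ℚ.* ι (if b then k else 0)
    entry true  k = refl
    entry false k = ≡-sym (ℚ.*-zeroʳ q)

  natWeight-edges : ∀ M S → natWeight (λ i j → bit (edges M i j)) S ≡ hits M S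
  natWeight-edges M S = Σ-cong (n G) λ i → Σ-cong (n G) λ j → entry (S i j) (edges M i j)
    where
    entry : ∀ x y → (if x then bit y else 0) ≡ bit (x ∧ y)
    entry true  y = refl
    entry false y = refl

  module _ (forest : Forest G) (ni : NoIsolated G) (p5 : P5Constrained G) where

    P5⇒strongly : StronglyEquistarable G
    P5⇒strongly = ni , λ T sub ne not-star γ γ≤1 → separate T sub γ γ≤1
      ([ ⊥-elim ∘ not-star , (λ d → d) ] (detect forest Saturating edge pair T sub ne))
      where
      edge : ∀ {a b} → a ~ b → ∃ λ M → Saturating M × partner M a ≡ b
      edge ab with saturate-edge forest p5 ab
      ... | M , pa , sat = M , sat , pa
      pair : ∀ {a b c d} → a ~ b → c ~ d → Disjoint a b c d →
             ∃ λ M → Saturating M × partner M a ≡ b × partner M c ≡ d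
      pair ab cd dis with saturate-two-edges forest p5 ab cd dis
      ... | M , pa , pc , sat = M , sat , pa , pc
      -- The factor `1ℚ` brings the indicator into the shape of `weight-ι`.
      indicator : Matching → V → V → ℚ
      indicator M i j = 1ℚ ℚ.* ι (bit (edges M i j))
      weight-indicator : ∀ M S → weight G (indicator M) S ≡ ι (hits M S)
      weight-indicator M S = trans (weight-ι 1ℚ (λ i j → bit (edges M i j)) S)
        (trans (ℚ.*-identityˡ _) (cong ι (natWeight-edges M S)))
      nonneg : ∀ M → NonNeg G (indicator M)
      nonneg M i j _ = subst (0ℚ ℚ.≤_) (≡-sym (ℚ.*-identityˡ _)) (ι≥0 (bit (edges M i j)))
      normalised : ∀ M → Saturating M → Normalised (indicator M)
      normalised M sat S sub star = trans (weight-indicator M S) (cong ι (maximal-star-hits ni M sat S sub star))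
      Separating : EdgeSet G → ℚ → Set
      Separating T γ = Σ (V → V → ℚ) λ φ → NonNeg G φ × Normalised φ × weight G φ T ≢ γ
      use : ∀ T γ M → Saturating M → ι (hits M T) ≢ γ → Separating T γ
      use T γ M sat h = indicator M , nonneg M , normalised M sat , h ∘ trans (≡-sym (weight-indicator M T))
      separate : ∀ T → SubE G T → ∀ γ → γ ℚ.≤ 1ℚ → Detected Saturating T → Separating T γ
      -- Two hits weigh more than 1, hence more than γ. In the other case the weights 1 and 0 are
      -- both attained, and γ differs from one of them.
      separate T sub γ γ≤1 (inj₁ (M , sat , two)) = use T γ M sat λ e →
        ℚ.<⇒≢ (ℚ.≤-<-trans γ≤1 (ι-mono-< two)) (≡-sym e)
      separate T sub γ γ≤1 (inj₂ ((M , sat , one) , (N , sat′ , none))) with γ ℚ.≟ 0ℚ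
      ... | no γ≢0   = use T γ N sat′ λ e → γ≢0 (trans (≡-sym e) (cong ι none))
      ... | yes refl = use T γ M sat λ e → ι1≢0 (trans (cong ι (≡-sym one)) e)
        where
        ι1≢0 : ι 1 ≢ 0ℚ
        ι1≢0 ()

    -- Being total on quadruples of vertices, it makes the supply of matchings finite and listable.
    -- Where the requested pairs are not edges or not disjoint, it falls back on fewer prescribed
    -- edges.
    choose : ((a , b , c , d) : V × V × V × V) → Σ Matching λ M → Saturating M ×
             (a ~ b → partner M a ≡ b) × (a ~ b → c ~ d → Disjoint a b c d → partner M c ≡ d)
    choose (a , b , c , d) with a ~? b | c ~? d | Disjoint? a b c d
    ... | yes ab | yes cd | yes dis = two (saturate-two-edges forest p5 ab cd dis)
      where
      two : (Σ Matching λ M → partner M a ≡ b × partner M c ≡ d × Saturating M) → _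
      two (M , pa , pc , sat) = M , sat , (λ _ → pa) , λ _ _ _ → pc
    ... | yes ab | no ¬cd | _ = one (saturate-edge forest p5 ab)
      where
      one : (Σ Matching λ M → partner M a ≡ b × Saturating M) → _
      one (M , pa , sat) = M , sat , (λ _ → pa) , λ _ cd _ → ⊥-elim (¬cd cd)
    ... | yes ab | yes _ | no ¬dis = one (saturate-edge forest p5 ab)
      where
      one : (Σ Matching λ M → partner M a ≡ b × Saturating M) → _
      one (M , pa , sat) = M , sat , (λ _ → pa) , λ _ _ dis → ⊥-elim (¬dis dis)
    ... | no ¬ab | _ | _ = proj₁ none , proj₂ none , (λ ab → ⊥-elim (¬ab ab)) , λ ab → ⊥-elim (¬ab ab)
      where
      none = saturate-none forest p5

    quadruples : List (V × V × V × V)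
    quadruples = cartesianProduct vs (cartesianProduct vs (cartesianProduct vs vs))
      where vs = allFin (n G)

    ∈-quadruples : ∀ q → q ∈ quadruples
    ∈-quadruples (a , b , c , d) = ∈-cartesianProduct⁺ (∈-allFin a)
      (∈-cartesianProduct⁺ (∈-allFin b) (∈-cartesianProduct⁺ (∈-allFin c) (∈-allFin d)))

    -- The additional head keeps the list nonempty even on the empty graph. It makes `total`
    -- positive and excludes the empty edge set in `natWeight⇒star`.
    family : List Matching
    family = proj₁ (saturate-none forest p5) ∷ map (proj₁ ∘ choose) quadruples

    family-saturating : All Saturating family
    family-saturating = proj₂ (saturate-none forest p5) ∷
      All-map⁺ (universal (λ q → proj₁ (proj₂ (choose q))) quadruples)

    in-family : ∀ q → proj₁ (choose q) ∈ family
    in-family q = there (∈-map⁺ (proj₁ ∘ choose) (∈-quadruples q))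

    -- By `size-bound` a digit is at most `n G * n G`. One successor puts the base above it; the
    -- other keeps the digit 1 below the base when the graph is empty.
    base : ℕ
    base = suc (suc (n G * n G))

    -- The generic combination: the indicators of the listed matchings are added with successive
    -- powers of `base` as coefficients.
    value : V → V → ℕ
    value i j = numeral base (λ M → bit (edges M i j)) family

    total : ℕ
    total = numeral base (λ _ → 1) family

    natWeight-value : ∀ S → natWeight value S ≡ numeral base (λ M → hits M S) family
    natWeight-value S = go family
      where
      go : ∀ Ms → natWeight (λ i j → numeral base (λ M → bit (edges M i j)) Ms) S
                  ≡ numeral base (λ M → hits M S) Ms
      go [] = Σ-zero (n G) λ i → Σ-zero (n G) λ j → entry (S i j)
        where
        entry : ∀ b → (if b then 0 else 0) ≡ 0
        entry true  = refl
        entry false = refl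
      go (M ∷ Ms) = trans
        (Σ-cong (n G) λ i → trans (Σ-cong (n G) λ j → entry (S i j) _ _) (Σ-affine (n G) base _ _))
        (trans (Σ-affine (n G) base _ _) (cong₂ (λ x y → x + y * base) (natWeight-edges M S) (go Ms)))
        where
        entry : ∀ b x y → (if b then x + y * base else 0) ≡ (if b then x else 0) + (if b then y else 0) * base
        entry true  x y = refl
        entry false x y = refl

    -- Read in a large base, the weight of S spells out its hits with every member of the family,
    -- so it agrees with the numeral 11…1 only if each matching hits S exactly once.
    natWeight≡total : ∀ S → natWeight value S ≡ total → All (λ M → hits M S ≡ 1) family
    natWeight≡total S e = numeral-injective (suc (n G * n G)) family
      (λ M → s≤s (≤-trans (size-bound (λ i j → S i j ∧ edges M i j)) (n≤1+n _))) (λ _ → s≤s (s≤s z≤n))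
      (trans (≡-sym (natWeight-value S)) e)

    star⇒natWeight : ∀ S → SubE G S → IsMaximalStar G S → natWeight value S ≡ total
    star⇒natWeight S sub star = trans (natWeight-value S) (numeral-cong base
      (All-map (λ {M} sat → maximal-star-hits ni M sat S sub star) family-saturating))

    natWeight⇒star : ∀ S → SubE G S → natWeight value S ≡ total → IsMaximalStar G S
    natWeight⇒star S sub e = nonempty? (any? λ i → any? λ j → S i j ≟ᵇ true)
      where
      once : ∀ {M} → M ∈ family → hits M S ≡ 1
      once = All-lookup (natWeight≡total S e)
      edge : ∀ {a b} → a ~ b → ∃ λ M → M ∈ family × partner M a ≡ b
      -- The repeated pair is not disjoint from itself, so this quadruple prescribes the single
      -- edge.
      edge {a} {b} ab with choose (a , b , a , b) | in-family (a , b , a , b)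
      ... | M , _ , pa , _ | M∈ = M , M∈ , pa ab
      pair : ∀ {a b c d} → a ~ b → c ~ d → Disjoint a b c d →
             ∃ λ M → M ∈ family × partner M a ≡ b × partner M c ≡ d
      pair {a} {b} {c} {d} ab cd dis with choose (a , b , c , d) | in-family (a , b , c , d)
      ... | M , _ , pa , pc | M∈ = M , M∈ , pa ab , pc ab cd dis
      never-none : ∀ {M} → M ∈ family → hits M S ≢ 0
      never-none M∈ none = 1+n≢0 (trans (≡-sym (once M∈)) none)
      undetected : ¬ Detected (_∈ family) S
      undetected (inj₁ (_ , M∈ , two))     = <⇒≢ two (≡-sym (once M∈))
      undetected (inj₂ (_ , _ , N∈ , none)) = never-none N∈ none
      nonempty? : Dec (NonEmptyE G S) → IsMaximalStar G S
      nonempty? (no empty) = ⊥-elim (never-none (here refl)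
        (size-zero _ λ i j f → empty (i , j , proj₁ (∧-true f))))
      nonempty? (yes ne) = [ (λ star → star) , ⊥-elim ∘ undetected ] (detect forest (_∈ family) edge pair S sub ne)

    P5⇒equistarable : Equistarable G
    P5⇒equistarable = ni , normalise (inverse (ι total) (ι-mono-< {0} {total} (s≤s z≤n)))
      where
      normalise : (∃ λ q → 0ℚ ℚ.≤ q × q ℚ.* ι total ≡ 1ℚ) → Σ (V → V → ℚ) λ φ → NonNeg G φ ×
                  (∀ S → SubE G S → (IsMaximalStar G S ⇔ (weight G φ S ≡ 1ℚ)))
      normalise (q , q≥0 , qD≡1) = φ , (λ i j _ → *-nonneg q≥0 (ι≥0 (value i j))) , λ S sub → mk⇔
        (λ star → trans (weight-ι q value S) (trans (cong (λ k → q ℚ.* ι k) (star⇒natWeight S sub star)) qD≡1))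
        (λ w → natWeight⇒star S sub (ι-injective (cancel (trans (≡-sym (weight-ι q value S)) w))))
        where
        φ : V → V → ℚ
        φ i j = q ℚ.* ι (value i j)
        cancel : ∀ {x} → q ℚ.* x ≡ 1ℚ → x ≡ ι total
        cancel {x} qx≡1 = begin
          x                       ≡⟨ ℚ.*-identityˡ x ⟨
          1ℚ ℚ.* x                ≡⟨ cong (ℚ._* x) qD≡1 ⟨
          (q ℚ.* ι total) ℚ.* x   ≡⟨ cong (ℚ._* x) (ℚ.*-comm q (ι total)) ⟩
          (ι total ℚ.* q) ℚ.* x   ≡⟨ ℚ.*-assoc (ι total) q x ⟩
          ι total ℚ.* (q ℚ.* x)   ≡⟨ cong (ι total ℚ.*_) qx≡1 ⟩
          ι total ℚ.* 1ℚ          ≡⟨ ℚ.*-identityʳ (ι total) ⟩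
          ι total ∎
          where open ≡-Reasoning

-- Components

-- What `IsComponent` says about the map, apart from connectedness. The field `closed` is what
-- carries degree bounds from `G` down to `H`.
record LocalEmbedding (H G : Graph) : Set where
  field
    to        : Fin (n H) → Fin (n G)
    injective : Injective G to
    adj-to    : ∀ x y → adj G (to x) (to y) ≡ adj H x y
    closed    : ∀ x v → Adj G (to x) v → ∃ λ y → to y ≡ v

module _ {H G : Graph} (E : LocalEmbedding H G) where
  open LocalEmbedding E

  Adj⁺ : ∀ {x y} → Adj H x y → Adj G (to x) (to y)
  Adj⁺ {x} {y} e = trans (adj-to x y) e

  Adj⁻ : ∀ {x y} → Adj G (to x) (to y) → Adj H x y
  Adj⁻ {x} {y} e = trans (≡-sym (adj-to x y)) e

  to-injective : ∀ {x y} → to x ≡ to y → x ≡ y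
  to-injective = injective _ _

  forest⁻ : Forest G → Forest H
  forest⁻ forest (k , 2≤k , f , inj , steps , back) = forest
    (k , 2≤k , to ∘ f , (λ i j e → inj i j (to-injective e)) , (λ i → Adj⁺ (steps i)) , Adj⁺ back)

  no-isolated⁻ : NoIsolated G → NoIsolated H
  no-isolated⁻ ni x with ni (to x)
  ... | v , xv with closed x v xv
  ...   | y , refl = y , Adj⁻ xv

  3≤deg⁻ : ∀ {x} → 3 ≤ deg G (to x) → 3 ≤ deg H x
  3≤deg⁻ {x} h with two-nbrs G (≤-trans (n≤1+n 2) h)
  ... | a , b , xa , xb , a≢b with third-nbr G h a b
  ...   | c , xc , c≢a , c≢b with closed x a xa | closed x b xb | closed x c xc
  ...     | a′ , refl | b′ , refl | c′ , refl =
    3≤deg H (Adj⁻ xa) (Adj⁻ xb) (Adj⁻ xc) (a≢b ∘ cong to) (c≢a ∘ ≡-sym ∘ cong to) (c≢b ∘ ≡-sym ∘ cong to)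

  3≤deg⁺ : ∀ {x} → 3 ≤ deg H x → 3 ≤ deg G (to x)
  3≤deg⁺ {x} h with two-nbrs H (≤-trans (n≤1+n 2) h)
  ... | a , b , xa , xb , a≢b with third-nbr H h a b
  ...   | c , xc , c≢a , c≢b =
    3≤deg G (Adj⁺ xa) (Adj⁺ xb) (Adj⁺ xc) (a≢b ∘ to-injective)
      (c≢a ∘ ≡-sym ∘ to-injective) (c≢b ∘ ≡-sym ∘ to-injective)

  P5-constrained⁻ : P5Constrained G → P5Constrained H
  P5-constrained⁻ p5 f inj steps =
    3≤deg⁻ (p5 (to ∘ f) (λ i j e → inj i j (to-injective e)) λ i → Adj⁺ (steps i))

-- Every vertex other than `v` has a neighbour, which can only be `v`. Moving `v` to position zero
-- by a transposition is therefore an isomorphism onto `K1 m`.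
centered⇒star : ∀ H v → NoIsolated H → (∀ {i j} → Adj H i j → v ≡ i ⊎ v ≡ j) → IsStar H
centered⇒star H@record { n = suc m } v ni centered = m , 1≤m (proj₁ (ni v)) (~⇒≢ H (proj₂ (ni v))) ,
  (π ⟨$⟩ʳ_) , (π ⟨$⟩ˡ_) , (λ x → inverseˡ π) , (λ y → inverseʳ π) , same
  where
  1≤m : ∀ {m} {v : Fin (suc m)} u → v ≢ u → 1 ≤ m
  1≤m {zero} {fzero} fzero v≢u = ⊥-elim (v≢u refl)
  1≤m {suc m} _ _ = s≤s z≤n
  π : Permutation (suc m) (suc m)
  π = transpose v fzero
  π-v : π ⟨$⟩ʳ v ≡ fzero
  π-v rewrite dec-true (v ≟ v) refl = refl
  center-nbr : ∀ {x} → x ≢ v → Adj H v x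
  center-nbr {x} x≢v with ni x
  ... | y , xy with centered xy
  ...   | inj₁ e = ⊥-elim (x≢v (≡-sym e))
  ...   | inj₂ refl = ~-sym H xy
  zero⇒v : ∀ {x} → π ⟨$⟩ʳ x ≡ fzero → x ≡ v
  zero⇒v {x} e = trans (≡-sym (inverseˡ π)) (trans (cong (π ⟨$⟩ˡ_) (trans e (≡-sym π-v))) (inverseˡ π))
  fzero≢fsuc : ∀ {m} {i : Fin m} → fzero ≢ fsuc i
  fzero≢fsuc ()
  same : ∀ x y → adj (K1 m) (π ⟨$⟩ʳ x) (π ⟨$⟩ʳ y) ≡ adj H x y
  same x y with π ⟨$⟩ʳ x in ex | π ⟨$⟩ʳ y in ey
  ... | fzero | fzero with zero⇒v {x} ex | zero⇒v {y} ey
  ...   | refl | refl = ≡-sym (irrefl H v)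
  same x y | fzero | fsuc _ with zero⇒v {x} ex
  ...   | refl = ≡-sym (center-nbr λ { refl → fzero≢fsuc (trans (≡-sym π-v) ey) })
  same x y | fsuc _ | fzero with zero⇒v {y} ey
  ...   | refl = ≡-sym (~-sym H (center-nbr λ { refl → fzero≢fsuc (trans (≡-sym π-v) ex) }))
  same x y | fsuc _ | fsuc _ = ≡-sym (≢true⇒false λ xy → neither (centered xy))
    where
    neither : ¬ (v ≡ x ⊎ v ≡ y)
    neither (inj₁ refl) = fzero≢fsuc (trans (≡-sym π-v) ex)
    neither (inj₂ refl) = fzero≢fsuc (trans (≡-sym π-v) ey)

-- The star dichotomy is applied to the set of all edges of the component. A common vertex makes it
-- a star; two disjoint edges supply the 2-matching whose existence `InternallyExtendable` demands,
-- and `P5⇒B` inside the component extends every such matching.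
P5⇒A : ∀ G → Forest G → NoIsolated G → P5Constrained G → CondA G
P5⇒A G forest ni p5 H e (inj , adj-e , connected , closed) =
  [ (λ { (v , c) → inj₁ (centered⇒star H v niH (oriented c)) }) , (λ found → inj₂ (extendable found)) ]
    (star-or-disjoint-edges H forestH (isEdge H) (λ i j → isEdge⁻ H) nonempty)
  where
  E : LocalEmbedding H G
  E = record { to = e ; injective = inj ; adj-to = adj-e ; closed = closed }
  forestH : Forest H
  forestH = forest⁻ E forest
  niH : NoIsolated H
  niH = no-isolated⁻ E ni
  nonempty : NonEmptyE H (isEdge H)
  nonempty with niH (fromℕ< (proj₁ connected))
  ... | u , vu with orient H vu
  ...   | inj₁ v<u = _ , u , isEdge⁺ H v<u vu
  ...   | inj₂ u<v = u , _ , isEdge⁺ H u<v (~-sym H vu)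
  oriented : ∀ {v} → Centered H v (isEdge H) → ∀ {i j} → Adj H i j → v ≡ i ⊎ v ≡ j
  oriented c {i} {j} ij with orient H ij
  ... | inj₁ i<j = c i j (isEdge⁺ H i<j ij)
  ... | inj₂ j<i = swap (c j i (isEdge⁺ H j<i (~-sym H ij)))
  extendable : (∃ λ a → ∃ λ b → ∃ λ c → ∃ λ d → Has H (isEdge H) a b × Has H (isEdge H) c d × Disjoint H a b c d) →
               InternallyExtendable H 2
  extendable (a , b , c , d , ab , cd , dis)
    with pair-2-matching H (Has⇒~ H (λ i j → isEdge⁻ H) ab) (Has⇒~ H (λ i j → isEdge⁻ H) cd) dis
  ... | M , m , _ = connected , (M , m) , P5⇒B H forestH niH (P5-constrained⁻ E p5)

star-edges-meet : ∀ H → IsStar H → ∀ {a b c d} → Adj H a b → Adj H c d → ¬ Disjoint H a b c d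
star-edges-meet H (m , _ , f , g , gf , _ , same) {a} {b} {c} {d} ab cd ((a≢c , a≢d) , (b≢c , b≢d)) =
  meet (touches-zero (trans (same a b) ab)) (touches-zero (trans (same c d) cd))
  where
  touches-zero : ∀ {x y} → adj (K1 m) x y ≡ true → x ≡ fzero ⊎ y ≡ fzero
  touches-zero {fzero}          _ = inj₁ refl
  touches-zero {fsuc _} {fzero} _ = inj₂ refl
  both-zero : ∀ {x y} → f x ≡ fzero → f y ≡ fzero → x ≡ y
  both-zero {x} {y} ex ey = trans (≡-sym (gf x)) (trans (cong g (trans ex (≡-sym ey))) (gf y))
  meet : f a ≡ fzero ⊎ f b ≡ fzero → f c ≡ fzero ⊎ f d ≡ fzero → ⊥
  meet (inj₁ x) (inj₁ y) = a≢c (both-zero x y)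
  meet (inj₁ x) (inj₂ y) = a≢d (both-zero x y)
  meet (inj₂ x) (inj₁ y) = b≢c (both-zero x y)
  meet (inj₂ x) (inj₂ y) = b≢d (both-zero x y)

-- The whole path lies in the component: `closed` pulls back the neighbours of `c` and then theirs.
-- A star has no room for the disjoint edges `ab` and `de`; otherwise `B⇒P5` applies inside `H` and
-- the degree bound is carried back to `G`.
component-degree : ∀ {H G} (E : LocalEmbedding H G) → IsStar H ⊎ InternallyExtendable H 2 →
                   ∀ (p : P5 G) x → LocalEmbedding.to E x ≡ P5.c p → 3 ≤ deg G (P5.c p)
component-degree {H} {G} E alt
  record { ab = ab ; bc = bc ; cd = cd ; de = de
         ; distinct = (a≢b ∷ a≢c ∷ a≢d ∷ a≢e ∷ []) ∷ (b≢c ∷ b≢d ∷ b≢e ∷ []) ∷ (c≢d ∷ c≢e ∷ []) ∷ (d≢e ∷ []) ∷ _ }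
  c refl with LocalEmbedding.closed E c _ (~-sym G bc) | LocalEmbedding.closed E c _ cd
... | b , refl | d , refl with LocalEmbedding.closed E b _ (~-sym G ab) | LocalEmbedding.closed E d _ de
...   | a , refl | e , refl = conclude alt
  where
  open LocalEmbedding E
  ab′ = Adj⁻ E ab
  bc′ = Adj⁻ E bc
  cd′ = Adj⁻ E cd
  de′ = Adj⁻ E de
  pull : ∀ {x y} → to x ≢ to y → x ≢ y
  pull h e = h (cong to e)
  conclude : IsStar H ⊎ InternallyExtendable H 2 → 3 ≤ deg G (to c)
  conclude (inj₁ star) = ⊥-elim (star-edges-meet H star ab′ de′ ((pull a≢d , pull a≢e) , (pull b≢d , pull b≢e)))
  conclude (inj₂ (_ , _ , ext)) = 3≤deg⁺ E (P5-middle H (B⇒P5 H ext) ab′ bc′ cd′ de′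
    ((pull a≢b ∷ pull a≢c ∷ pull a≢d ∷ pull a≢e ∷ []) ∷ (pull b≢c ∷ pull b≢d ∷ pull b≢e ∷ [])
      ∷ (pull c≢d ∷ pull c≢e ∷ []) ∷ (pull d≢e ∷ []) ∷ [] ∷ []))

reachable : ∀ G {u v} → Star (Adj G) u v → Reachable G u v
reachable G {u} ε = 0 , (λ _ → u) , refl , refl , λ ()
reachable G {u} (_◅_ {j = w} uw k) with reachable G k
... | l , f , start , end , steps = suc l , f′ , refl , end , steps′
  where
  f′ : Fin (suc (suc l)) → Fin (n G)
  f′ fzero    = u
  f′ (fsuc i) = f i
  steps′ : ∀ (i : Fin (suc l)) → Adj G (f′ (inject₁ i)) (f′ (fsuc i))
  steps′ fzero    = subst (Adj G u) (≡-sym start) uw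
  steps′ (fsuc i) = steps i

module Component (G : Graph) (root : Fin (n G)) (reach? : ∀ v → Dec (Star (Adj G) root v)) where

  vertices : List (Fin (n G))
  vertices = filter reach? (allFin (n G))

  vertex : Fin (length vertices) → Fin (n G)
  vertex = lookup vertices

  reaches : ∀ x → Star (Adj G) root (vertex x)
  reaches x = proj₂ (∈-filter⁻ reach? {xs = allFin (n G)} (∈-lookup x))

  index-of : ∀ {v} → Star (Adj G) root v → ∃ λ x → vertex x ≡ v
  index-of {v} k = index v∈ , ≡-sym (lookup-index v∈)
    where
    v∈ : v ∈ vertices
    v∈ = ∈-filter⁺ reach? (∈-allFin v) k

  H : Graph
  H = record
    { n = length vertices ; adj = λ x y → adj G (vertex x) (vertex y)
    ; sym = λ x y → sym G (vertex x) (vertex y) ; irrefl = λ x → irrefl G (vertex x) }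

  closed : ∀ x v → Adj G (vertex x) v → ∃ λ y → vertex y ≡ v
  closed x v e = index-of (reaches x ◅◅ e ◅ ε)

  embedding : LocalEmbedding H G
  embedding = record
    { to = vertex
    ; injective = lookup-injective G (filter⁺ reach? (allFin⁺ (n G)))
    ; adj-to = λ _ _ → refl
    ; closed = closed }

  lift : ∀ {x w} → Star (Adj G) (vertex x) w → ∀ y → vertex y ≡ w → Star (Adj H) x y
  lift {x} ε y e with lookup-injective G (filter⁺ reach? (allFin⁺ (n G))) x y (≡-sym e)
  ... | refl = ε
  lift {x} (_◅_ {j = z} e k) y ey with closed x z e
  ... | z′ , refl = e ◅ lift k y ey

  connected : Connected H
  connected = nonempty (proj₁ (index-of ε)) , λ x y →
    reachable H (lift (reverse (λ {u} {v} → ~-sym G {u} {v}) (reaches x) ◅◅ reaches y) y refl)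
    where
    nonempty : ∀ {m} → Fin m → 1 ≤ m
    nonempty fzero    = s≤s z≤n
    nonempty (fsuc _) = s≤s z≤n

  component : IsComponent H G vertex
  component = LocalEmbedding.injective embedding , (λ _ _ → refl) , connected , closed

-- Double negation commutes with finite conjunctions, so excluded middle may be assumed at all
-- vertices at once. This replaces a decision procedure for reachability.
¬¬-decidable : ∀ m {P : Fin m → Set} → ¬ ¬ (∀ i → Dec (P i))
¬¬-decidable zero    k = k λ ()
¬¬-decidable (suc m) k = ¬¬-excluded-middle λ d → ¬¬-decidable m λ ds → k λ { fzero → d ; (fsuc i) → ds i }

-- The conclusion 3 ≤ deg c is stable, so reachability from c may be assumed decidable.
A⇒P5 : ∀ G → CondA G → P5Constrained G
A⇒P5 G condA = P5-constrained G λ p → decidable-stable (3 ≤? _) λ small →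
  ¬¬-decidable (n G) {Star (Adj G) (P5.c p)} λ reach? → small (degree p reach?)
  where
  degree : ∀ p → (∀ v → Dec (Star (Adj G) (P5.c p) v)) → 3 ≤ deg G (P5.c p)
  degree p reach? = component-degree embedding (condA H vertex component) p (proj₁ (index-of ε)) (proj₂ (index-of ε))
    where open Component G (P5.c p) reach?

theorem5 : ∀ (G : Graph) → Forest G → NoIsolated G →
    (CondA G ⇔ CondB G) × (CondA G ⇔ StronglyEquistarable G) ×
    (CondA G ⇔ Equistarable G) × (CondA G ⇔ P5Constrained G)
theorem5 G forest ni =
    mk⇔ (P5⇒B G forest ni ∘ A⇒P5 G) (P5⇒A G forest ni ∘ B⇒P5 G)
  , mk⇔ (P5⇒strongly G forest ni ∘ A⇒P5 G) (P5⇒A G forest ni ∘ strongly⇒P5 G forest)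
  , mk⇔ (P5⇒equistarable G forest ni ∘ A⇒P5 G) (P5⇒A G forest ni ∘ equistarable⇒P5 G forest)
  , mk⇔ (A⇒P5 G) (P5⇒A G forest ni)
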